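{- Let $\mathfrak A$ be an $\aleph_0$-categorical structure with at least two elements and let $\mathfrak B$ be a structure. Then the following are equivalent: (1) $\mathfrak B$ is existentially interpretable in $\mathfrak A$; (2) there is a continuous monoid homomorphism $f:\mathrm{Emb}(\mathfrak A)\to\mathrm{End}(\mathfrak B)$ such that $B$ is covered by finitely many orbits under the image $f[\mathrm{Emb}(\mathfrak A)]$; (3) there is a continuous monoid homomorphism $f:\mathrm{Emb}(\mathfrak A)\to\mathrm{End}(\mathfrak B)$ such that $B$ is covered by finitely many orbits under $f[\mathrm{Aut}(\mathfrak A)]$.
   Context: All structures are in an at most countable signature without function symbols (relation symbols, possibly constants); $A,B$ denote the universes of $\mathfrak A,\mathfrak B$. A structure is called $\aleph_0$-categorical if it is finite or a countable model of an $\aleph_0$-categorical theory in an at most countable language. Definability is without parameters. $\mathrm{Aut}(\mathfrak M)$ is the automorphism group, $\mathrm{Emb}(\mathfrak M)$ the monoid of self-embeddings (isomorphisms of $\mathfrak M$ onto a substructure of $\mathfrak M$), and $\mathrm{End}(\mathfrak M)$ the monoid of endomorphisms (homomorphisms $\mathfrak M\to\mathfrak M$). Maps act from the right: $x^{\sigma}=\sigma(x)$, $x^{\sigma\tau}=\tau(\sigma(x))$. These monoids carry the topology of pointwise convergence, with basic open sets $U_{\bar a,\bar b}=\{\sigma\mid \bar a^\sigma=\bar b\}$ for finite tuples $\bar a,\bar b$. For a set $\Sigma$ of maps $B\to B$, the orbit of $b\in B$ under $\Sigma$ is $\{b^\sigma\mid\sigma\in\Sigma\}$. The basic sets of a structure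 are its universe, the diagonal (equality relation), the interpretations of the relation symbols, and the (graphs of the) interpretations of the constants. An interpretation of $\mathfrak B$ in $\mathfrak A$ is a surjection $i:U\to B$ with $U\subseteq A^n$ for some $n$, such that the inverse images under $i$ (taken componentwise) of all basic sets of $\mathfrak B$ are definable in $\mathfrak A$; it is existential if all these inverse images are definable in $\mathfrak A$ by existential formulas. $\mathfrak B$ is existentially interpretable in $\mathfrak A$ if such an existential interpretation exists. -}

module Defs where

open import Algebra.Bundles using (Monoid)
open import Algebra.Morphism.Structures using (module MonoidMorphisms)
open import Data.Fin.Base using (Fin)
open import Data.List.Base using (List)
open import Data.List.Relation.Unary.Any using (Any)
open import Data.Nat.Base using (ℕ; suc; _*_)
open import Data.Product.Base using (∃; ∃₂; _×_; _,_)
open import Data.Refinement.Base using (Refinement-syntax; value)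
open import Data.Sum.Base using (_⊎_)
open import Data.Vec.Base as Vec using (Vec; []; _∷_)
open import Data.Vec.Properties using (map-id; map-∘)
open import Function.Base using (id; _∘_)
open import Function.Bundles using (_↔_; _↣_; _⇔_; mk⇔; Equivalence)
open import Function.Definitions using (Injective; Surjective)
open import Level using (0ℓ)
open import Relation.Binary.PropositionalEquality
  using (_≡_; _≢_; _≗_; refl; sym; trans; cong; subst)
open import Relation.Nullary.Negation using (¬_)
open import Relation.Unary using (Pred; _∈_; _⊆_; _⊢_; U)

------------------------------------------------------------------------
-- Structures in an at most countable signature without function symbols

record Signature : Set₁ where
  field
    Rel             : Set
    arity           : Rel → ℕ
    Const           : Set
    Rel-countable   : Rel ↣ ℕ
    Const-countable : Const ↣ ℕ

open Signature public

record Structure (L : Signature) : Set₁ where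
  field
    Carrier  : Set
    relation : (R : Rel L) → Pred (Vec Carrier (arity L R)) 0ℓ
    constant : Const L → Carrier

open Structure public

private
  variable
    L L′ : Signature

------------------------------------------------------------------------
-- First-order formulas; variables are de Bruijn indices

data Term (L : Signature) (n : ℕ) : Set where
  var   : Fin n → Term L n
  const : Const L → Term L n

infix  8 _≐_
infix  7 ∼_
infixr 6 _∧_
infixr 5 _∨_

data Formula (L : Signature) (n : ℕ) : Set where
  _≐_     : Term L n → Term L n → Formula L n
  rel     : (R : Rel L) → Vec (Term L n) (arity L R) → Formula L n
  ∼_      : Formula L n → Formula L n
  _∧_ _∨_ : Formula L n → Formula L n → Formula L n
  all ex  : Formula L (suc n) → Formula L n

data QuantifierFree {L : Signature} {n : ℕ} : Formula L n → Set where
  _≐_ : ∀ s t → QuantifierFree (s ≐ t)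
  rel : ∀ R ts → QuantifierFree (rel R ts)
  ∼_  : ∀ {φ} → QuantifierFree φ → QuantifierFree (∼ φ)
  _∧_ : ∀ {φ ψ} → QuantifierFree φ → QuantifierFree ψ → QuantifierFree (φ ∧ ψ)
  _∨_ : ∀ {φ ψ} → QuantifierFree φ → QuantifierFree ψ → QuantifierFree (φ ∨ ψ)

data Existential {L : Signature} {n : ℕ} : Formula L n → Set where
  qf : ∀ {φ} → QuantifierFree φ → Existential φ
  ex : ∀ {φ} → Existential {n = suc n} φ → Existential (ex φ)

module _ (𝔐 : Structure L) where

  evalTerm : ∀ {n} → Vec (Carrier 𝔐) n → Term L n → Carrier 𝔐
  evalTerm ρ (var x)   = Vec.lookup ρ x
  evalTerm ρ (const c) = constant 𝔐 c

  Sat : ∀ {n} → Formula L n → Pred (Vec (Carrier 𝔐) n) 0ℓ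
  Sat (s ≐ t)    ρ = evalTerm ρ s ≡ evalTerm ρ t
  Sat (rel R ts) ρ = relation 𝔐 R (Vec.map (evalTerm ρ) ts)
  Sat (∼ φ)      ρ = ¬ Sat φ ρ
  Sat (φ ∧ ψ)    ρ = Sat φ ρ × Sat ψ ρ
  Sat (φ ∨ ψ)    ρ = Sat φ ρ ⊎ Sat ψ ρ
  Sat (all φ)    ρ = ∀ a → Sat φ (a ∷ ρ)
  Sat (ex φ)     ρ = ∃ λ a → Sat φ (a ∷ ρ)

Theory : Signature → Set₁
Theory L = Pred (Formula L 0) 0ℓ

_IsModelOf_ : Structure L → Theory L → Set
𝔐 IsModelOf T = ∀ φ → φ ∈ T → Sat 𝔐 φ []

------------------------------------------------------------------------
-- Homomorphisms and embeddings

record Homomorphism (𝔐 𝔑 : Structure L) : Set where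
  field
    map       : Carrier 𝔐 → Carrier 𝔑
    preserves : ∀ R {xs} → relation 𝔐 R xs → relation 𝔑 R (Vec.map map xs)
    fixes     : ∀ c → map (constant 𝔐 c) ≡ constant 𝔑 c

record Embedding (𝔐 𝔑 : Structure L) : Set where
  field
    map       : Carrier 𝔐 → Carrier 𝔑
    injective : Injective _≡_ _≡_ map
    preserves : ∀ R {xs} → relation 𝔐 R xs ⇔ relation 𝔑 R (Vec.map map xs)
    fixes     : ∀ c → map (constant 𝔐 c) ≡ constant 𝔑 c

module Hom = Homomorphism
module Emb = Embedding

IsIsomorphism : {𝔐 𝔑 : Structure L} → Pred (Embedding 𝔐 𝔑) 0ℓ
IsIsomorphism σ = Surjective _≡_ _≡_ (Emb.map σ)

_≅_ : Structure L → Structure L → Set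
𝔐 ≅ 𝔑 = ∃ λ (σ : Embedding 𝔐 𝔑) → IsIsomorphism σ

------------------------------------------------------------------------
-- ℵ₀-categoricity

Finite CountablyInfinite : Set → Set
Finite A            = ∃ λ n → A ↔ Fin n
CountablyInfinite A = A ↔ ℕ

CountableModel : Theory L → Pred (Structure L) 0ℓ
CountableModel T 𝔐 = CountablyInfinite (Carrier 𝔐) × 𝔐 IsModelOf T

ℵ₀-CategoricalTheory : Theory L → Set₁
ℵ₀-CategoricalTheory T =
  ∃ (CountableModel T) ×
  (∀ 𝔐 𝔑 → CountableModel T 𝔐 → CountableModel T 𝔑 → 𝔐 ≅ 𝔑)

ℵ₀-Categorical : Structure L → Set₁
ℵ₀-Categorical {L} 𝔐 =
  Finite (Carrier 𝔐) ⊎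
  ∃ λ (T : Theory L) → ℵ₀-CategoricalTheory T × CountableModel T 𝔐

AtLeastTwoElements : Structure L → Set
AtLeastTwoElements 𝔐 = ∃₂ λ (x y : Carrier 𝔐) → x ≢ y

------------------------------------------------------------------------
-- The monoids End and Emb.  Maps act from the right: x^(στ) = τ(σ(x)).

module _ (𝔐 : Structure L) where

  End : Monoid 0ℓ 0ℓ
  End = record
    { Carrier  = Homomorphism 𝔐 𝔐
    ; _≈_      = λ σ τ → Hom.map σ ≗ Hom.map τ
    ; _∙_      = λ σ τ → record
      { map       = Hom.map τ ∘ Hom.map σ
      ; preserves = λ R {xs} r →
          subst (relation 𝔐 R) (sym (map-∘ (Hom.map τ) (Hom.map σ) xs))
            (Hom.preserves τ R (Hom.preserves σ R r))
      ; fixes     = λ c →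
          trans (cong (Hom.map τ) (Hom.fixes σ c)) (Hom.fixes τ c)
      }
    ; ε        = record
      { map       = id
      ; preserves = λ R {xs} → subst (relation 𝔐 R) (sym (map-id xs))
      ; fixes     = λ _ → refl
      }
    ; isMonoid = record
      { isSemigroup = record
        { isMagma = record
          { isEquivalence = record
            { refl  = λ _ → refl
            ; sym   = λ p x → sym (p x)
            ; trans = λ p q x → trans (p x) (q x)
            }
          ; ∙-cong = λ {_} {_} {τ} p q x →
              trans (cong (Hom.map τ) (p x)) (q _)
          }
        ; assoc = λ _ _ _ _ → refl
        }
      ; identity = (λ _ _ → refl) , (λ _ _ → refl)
      }
    }

  Emb : Monoid 0ℓ 0ℓ
  Emb = record
    { Carrier  = Embedding 𝔐 𝔐
    ; _≈_      = λ σ τ → Emb.map σ ≗ Emb.map τ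
    ; _∙_      = λ σ τ → record
      { map       = Emb.map τ ∘ Emb.map σ
      ; injective = Emb.injective σ ∘ Emb.injective τ
      ; preserves = λ R {xs} →
          let στ = map-∘ (Emb.map τ) (Emb.map σ) xs in mk⇔
            (subst (relation 𝔐 R) (sym στ)
              ∘ Equivalence.to (Emb.preserves τ R)
              ∘ Equivalence.to (Emb.preserves σ R))
            (Equivalence.from (Emb.preserves σ R)
              ∘ Equivalence.from (Emb.preserves τ R)
              ∘ subst (relation 𝔐 R) στ)
      ; fixes     = λ c →
          trans (cong (Emb.map τ) (Emb.fixes σ c)) (Emb.fixes τ c)
      }
    ; ε        = record
      { map       = id
      ; injective = id
      ; preserves = λ R {xs} → mk⇔
          (subst (relation 𝔐 R) (sym (map-id xs)))
          (subst (relation 𝔐 R) (map-id xs))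
      ; fixes     = λ _ → refl
      }
    ; isMonoid = record
      { isSemigroup = record
        { isMagma = record
          { isEquivalence = record
            { refl  = λ _ → refl
            ; sym   = λ p x → sym (p x)
            ; trans = λ p q x → trans (p x) (q x)
            }
          ; ∙-cong = λ {_} {_} {τ} p q x →
              trans (cong (Emb.map τ) (p x)) (q _)
          }
        ; assoc = λ _ _ _ _ → refl
        }
      ; identity = (λ _ _ → refl) , (λ _ _ → refl)
      }
    }

  -- Aut(𝔐) as a subset of Emb(𝔐).
  Aut : Pred (Embedding 𝔐 𝔐) 0ℓ
  Aut = IsIsomorphism

------------------------------------------------------------------------
-- The topology of pointwise convergence on a set X of maps A → A, where
-- act gives the map underlying an element of X

module Pointwise {X A : Set} (act : X → A → A) where

  -- U_{ā,b̄} = { σ ∣ ā^σ = b̄ }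
  Basic : ∀ {n} → Vec A n → Vec A n → Pred X 0ℓ
  Basic ā b̄ σ = Vec.map (act σ) ā ≡ b̄

  Open : Pred (Pred X 0ℓ) 0ℓ
  Open O = ∀ {σ} → σ ∈ O →
    ∃ λ n → ∃₂ λ (ā b̄ : Vec A n) → σ ∈ Basic ā b̄ × Basic ā b̄ ⊆ O

record ContinuousMonoidHomomorphism
  (𝔄 : Structure L) (𝔅 : Structure L′) : Set₁ where
  open Monoid using (rawMonoid)
  open MonoidMorphisms (rawMonoid (Emb 𝔄)) (rawMonoid (End 𝔅))
  private
    module E𝔄 = Pointwise {X = Embedding 𝔄 𝔄} Emb.map
    module E𝔅 = Pointwise {X = Homomorphism 𝔅 𝔅} Hom.map
  field
    fun                  : Embedding 𝔄 𝔄 → Homomorphism 𝔅 𝔅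
    isMonoidHomomorphism : IsMonoidHomomorphism fun
    continuous           : ∀ {O} → E𝔅.Open O → E𝔄.Open (fun ⊢ O)

  -- The image f[Σ].
  image : Pred (Embedding 𝔄 𝔄) 0ℓ → Pred (Homomorphism 𝔅 𝔅) 0ℓ
  image Σ g = ∃ λ σ → σ ∈ Σ × Hom.map (fun σ) ≗ Hom.map g

module _ {𝔅 : Structure L} (Σ : Pred (Homomorphism 𝔅 𝔅) 0ℓ) where

  Orbit : Carrier 𝔅 → Pred (Carrier 𝔅) 0ℓ
  Orbit b x = ∃ λ σ → σ ∈ Σ × Hom.map σ b ≡ x

  CoveredByFinitelyManyOrbits : Set
  CoveredByFinitelyManyOrbits =
    ∃ λ (bs : List (Carrier 𝔅)) → ∀ x → Any (λ b → x ∈ Orbit b) bs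

------------------------------------------------------------------------
-- Definability and interpretations

-- A k-ary relation on Mⁿ is regarded as a (k * n)-ary relation on M.

Defines : (𝔐 : Structure L) {k n : ℕ} →
          Formula L (k * n) → Pred (Vec (Vec (Carrier 𝔐) n) k) 0ℓ → Set
Defines 𝔐 φ S = ∀ ās → Sat 𝔐 φ (Vec.concat ās) ⇔ ās ∈ S

module _ (𝔐 : Structure L) {k n : ℕ}
         (S : Pred (Vec (Vec (Carrier 𝔐) n) k) 0ℓ) where

  Definable : Set
  Definable = ∃ λ φ → Defines 𝔐 φ S

  ExistentiallyDefinable : Set
  ExistentiallyDefinable = ∃ λ φ → Existential φ × Defines 𝔐 φ S

data BasicSet (L : Signature) : Set where
  universe diagonal : BasicSet L
  rel               : Rel L → BasicSet L
  const             : Const L → BasicSet L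

basicArity : BasicSet L → ℕ
basicArity         universe  = 1
basicArity         diagonal  = 2
basicArity {L = L} (rel R)   = arity L R
basicArity         (const c) = 1

⟦_⟧ : (s : BasicSet L) (𝔐 : Structure L) →
      Pred (Vec (Carrier 𝔐) (basicArity s)) 0ℓ
⟦ universe ⟧ 𝔐 = U
⟦ diagonal ⟧ 𝔐 (x ∷ y ∷ []) = x ≡ y
⟦ rel R    ⟧ 𝔐 = relation 𝔐 R
⟦ const c  ⟧ 𝔐 (x ∷ []) = x ≡ constant 𝔐 c

-- The domain is a refinement type, so that the value of i at a tuple of
-- the domain cannot depend on the proof of membership.

record Interpretation (𝔅 : Structure L′) (𝔄 : Structure L) : Set₁ where
  field
    dim : ℕ
    dom : Pred (Vec (Carrier 𝔄) dim) 0ℓ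
    i   : [ ā ∈ Vec (Carrier 𝔄) dim ∣ dom ā ] → Carrier 𝔅
    surjective : Surjective _≡_ _≡_ i

  preimage : ∀ {k} → Pred (Vec (Carrier 𝔅) k) 0ℓ →
             Pred (Vec (Vec (Carrier 𝔄) dim) k) 0ℓ
  preimage S ās = ∃ λ us → Vec.map value us ≡ ās × Vec.map i us ∈ S

  field
    definable : ∀ s → Definable 𝔄 (preimage (⟦ s ⟧ 𝔅))

  IsExistential : Set
  IsExistential = ∀ s → ExistentiallyDefinable 𝔄 (preimage (⟦ s ⟧ 𝔅))

_ExistentiallyInterpretableIn_ : Structure L′ → Structure L → Set₁
𝔅 ExistentiallyInterpretableIn 𝔄 =
  ∃ λ (I : Interpretation 𝔅 𝔄) → Interpretation.IsExistential I

{-# OPTIONS --safe #-}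
module Submission where

-- Write b^σ for the action of an embedding σ through f.
--
-- (1) ⇒ (3): embeddings preserve existential formulas, so i(ā)^σ = i(ā^σ) is
-- well defined; by Ryll-Nardzewski, Aut(𝔄) has finitely many orbits on tuples.
--
-- (2) ⇒ (1): finiteness of the number of orbits makes Emb(𝔄) modulo Aut(𝔄)
-- compact, so b^σ depends, uniformly in σ, only on the restriction of σ to a
-- finite tuple c̄.  Hence c̄^σ ↦ b^σ is well defined, and coding by equality
-- patterns which b is meant combines these maps for representatives b of the
-- orbits into a surjection onto B.  Its domain and the preimages of the basic
-- sets are closed under Emb(𝔄), and such sets are existentially definable,
-- because a map preserving the existential type of a tuple extends to an
-- embedding and only finitely many such types are realised.
--
-- For Ryll-Nardzewski, the uniqueness of the countable model is played against
-- Henkin models which omit a nonisolated type (so all types realised in 𝔄 are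
-- isolated), respectively realise a tuple outside all orbits.

open import Defs
open import Algebra.Bundles using (Monoid)
open import Algebra.Morphism.Structures using (module MonoidMorphisms)
open import Axiom.ExcludedMiddle using (ExcludedMiddle)
open import Data.Empty using (⊥; ⊥-elim)
open import Data.Fin.Base as Fin using (Fin; zero; suc)
import Data.Fin.Properties as Fin
open import Data.Irrelevant as Irrelevant using ([_])
open import Data.List.Base as List
  using (List; []; _∷_; _++_; concat; concatMap; cartesianProductWith; upTo; allFin)
open import Data.List.Membership.Propositional using () renaming (_∈_ to _∈ₗ_)
import Data.List.Membership.Propositional.Properties as ∈ₗ
import Data.List.Properties as List
open import Data.List.Relation.Binary.Subset.Propositional using () renaming (_⊆_ to _⊆ₗ_)
open import Data.List.Relation.Unary.All as All using (All; []; _∷_)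
import Data.List.Relation.Unary.All.Properties as All
open import Data.List.Relation.Unary.Any as Any using (Any; here; there)
import Data.List.Relation.Unary.Any.Properties as Any
open import Data.Nat.Base using (ℕ; zero; suc; _+_; _*_; _∸_; _≤_; _<_; z≤n; s≤s; _⊔_)
import Data.Nat.Properties as ℕ
open import Data.Nat.DivMod using (_mod_; m<n⇒m%n≡m)
open import Data.Product.Base as Product using (∃; ∃₂; _×_; _,_; proj₁; proj₂)
open import Data.Refinement.Base using (Refinement-syntax; value; _,_)
open import Data.Sum.Base as Sum using (_⊎_; inj₁; inj₂)
open import Data.Unit.Base using (⊤; tt)
open import Data.Vec.Base as Vec using (Vec; []; _∷_)
import Data.Vec.Properties as Vec
import Data.Vec.Membership.Propositional.Properties as ∈ᵥ
open import Data.Vec.Relation.Unary.All as VecAll using ([]; _∷_) renaming (All to VecAll)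
import Data.Vec.Relation.Unary.All.Properties as VecAll
open import Function.Base using (id; _∘_)
open import Function.Bundles using (_↣_; _⇔_; mk⇔; mk↣; Equivalence; Inverse; Injection)
open import Function.Construct.Composition using (_⇔-∘_)
open import Function.Construct.Identity using (⇔-id; ↔-id)
open import Function.Construct.Symmetry using (⇔-sym; ↔-sym)
open import Function.Properties.Inverse using (↔⇒↣)
open import Data.Product.Function.NonDependent.Propositional using (_×-⇔_)
open import Data.Sum.Function.Propositional using (_⊎-⇔_)
open import Level using (0ℓ)
open import Relation.Binary.Definitions using (tri<; tri≈; tri>)
open import Relation.Binary.PropositionalEquality
open import Relation.Nullary using (¬_; yes; no; contradiction; recompute)
open import Relation.Nullary.Decidable using (decidable-stable)
open import Relation.Unary using (Pred; _∈_; _⊆_; U)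

open Equivalence using (to; from)

-- There is no proof calculus and no completeness theorem here: a finite set of conditions counts as
-- consistent if assignments into `𝔄` satisfy it. A Henkin model built from such conditions
-- satisfies every sentence true in `𝔄`, and categoricity turns it into an enumeration of `𝔄`
-- itself, so whatever was arranged about the type holds in `𝔄`.
--
-- Embeddings, automorphisms, complete types and accumulation points of embeddings all arise from
-- one construction, a filter of finite conditions meeting countably many dense sets. In particular
-- the compactness argument uses no topology on a quotient: the limit is a graph assembled from
-- finite pieces, each corrected by an automorphism.
--
-- Existential formulas lack negations. Maps preserving them are extended forth but not back, which
-- yields embeddings, and isolating an existential type means only that the isolating formula
-- implies it.
--
-- Two distinct elements are wanted because one domain must carry several representatives b, whose
-- tuples have to stay apart under any two embeddings. Excluded middle, applied to types of
-- witnesses, also serves as choice.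

private
  variable
    L L′ : Signature
    m n  : ℕ

infixr 9 _⟨⇔⟩_

_⟨⇔⟩_ : {P Q R : Set} → P ⇔ Q → Q ⇔ R → P ⇔ R
p ⟨⇔⟩ q = q ⇔-∘ p

≡⇒⇔ : {A : Set} (P : A → Set) {x y : A} → x ≡ y → P x ⇔ P y
≡⇒⇔ P refl = ⇔-id _

¬-⇔ : {P Q : Set} → P ⇔ Q → (¬ P) ⇔ (¬ Q)
¬-⇔ p = mk⇔ (_∘ from p) (_∘ to p)

∃-⇔ : {A : Set} {P Q : A → Set} → (∀ a → P a ⇔ Q a) → ∃ P ⇔ ∃ Q
∃-⇔ p = mk⇔ (Product.map₂ (to (p _))) (Product.map₂ (from (p _)))

Π-⇔ : {A : Set} {P Q : A → Set} → (∀ a → P a ⇔ Q a) → (∀ a → P a) ⇔ (∀ a → Q a)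
Π-⇔ p = mk⇔ (λ f a → to (p a) (f a)) (λ f a → from (p a) (f a))

-- Formulas under renamings, embeddings and isomorphisms

renameTerm : (Fin m → Fin n) → Term L m → Term L n
renameTerm f (var x)   = var (f x)
renameTerm f (const c) = const c

rename : (Fin m → Fin n) → Formula L m → Formula L n
rename f (s ≐ t)    = renameTerm f s ≐ renameTerm f t
rename f (rel R ts) = rel R (Vec.map (renameTerm f) ts)
rename f (∼ φ)      = ∼ rename f φ
rename f (φ ∧ ψ)    = rename f φ ∧ rename f ψ
rename f (φ ∨ ψ)    = rename f φ ∨ rename f ψ
rename f (all φ)    = all (rename (Fin.lift 1 f) φ)
rename f (ex φ)     = ex (rename (Fin.lift 1 f) φ)

rename-qf : {f : Fin m → Fin n} {φ : Formula L m} → QuantifierFree φ → QuantifierFree (rename f φ)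
rename-qf (s ≐ t)    = _ ≐ _
rename-qf (rel R ts) = rel _ _
rename-qf (∼ p)      = ∼ rename-qf p
rename-qf (p ∧ q)    = rename-qf p ∧ rename-qf q
rename-qf (p ∨ q)    = rename-qf p ∨ rename-qf q

rename-existential : {f : Fin m → Fin n} {φ : Formula L m} → Existential φ → Existential (rename f φ)
rename-existential (qf p) = qf (rename-qf p)
rename-existential (ex p) = ex (rename-existential p)

module _ (𝔐 : Structure L) where

  evalTerm-rename : {f : Fin m → Fin n} {ρ : Vec (Carrier 𝔐) m} {ρ′ : Vec (Carrier 𝔐) n} →
                    (∀ x → Vec.lookup ρ′ (f x) ≡ Vec.lookup ρ x) →
                    ∀ t → evalTerm 𝔐 ρ′ (renameTerm f t) ≡ evalTerm 𝔐 ρ t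
  evalTerm-rename eq (var x)   = eq x
  evalTerm-rename eq (const c) = refl

  Sat-rename : {f : Fin m → Fin n} {ρ : Vec (Carrier 𝔐) m} {ρ′ : Vec (Carrier 𝔐) n} →
               (∀ x → Vec.lookup ρ′ (f x) ≡ Vec.lookup ρ x) →
               ∀ φ → Sat 𝔐 (rename f φ) ρ′ ⇔ Sat 𝔐 φ ρ
  Sat-rename eq (s ≐ t) =
    subst₂ (λ x y → (x ≡ y) ⇔ _)
      (sym (evalTerm-rename eq s)) (sym (evalTerm-rename eq t)) (⇔-id _)
  Sat-rename eq (rel R ts) = ≡⇒⇔ (relation 𝔐 R)
    (trans (sym (Vec.map-∘ _ _ ts)) (Vec.map-cong (evalTerm-rename eq) ts))
  Sat-rename eq (∼ φ)   = ¬-⇔ (Sat-rename eq φ)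
  Sat-rename eq (φ ∧ ψ) = Sat-rename eq φ ×-⇔ Sat-rename eq ψ
  Sat-rename eq (φ ∨ ψ) = Sat-rename eq φ ⊎-⇔ Sat-rename eq ψ
  Sat-rename eq (all φ) = Π-⇔ λ a → Sat-rename (λ { zero → refl ; (suc x) → eq x }) φ
  Sat-rename eq (ex φ)  = ∃-⇔ λ a → Sat-rename (λ { zero → refl ; (suc x) → eq x }) φ

module _ {𝔐 𝔑 : Structure L} (σ : Embedding 𝔐 𝔑) where

  evalTerm-embed : (ρ : Vec (Carrier 𝔐) n) → ∀ t →
                   evalTerm 𝔑 (Vec.map (Emb.map σ) ρ) t ≡ Emb.map σ (evalTerm 𝔐 ρ t)
  evalTerm-embed ρ (var x)   = Vec.lookup-map x _ ρ
  evalTerm-embed ρ (const c) = sym (Emb.fixes σ c)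

  private
    ≐-embed : (ρ : Vec (Carrier 𝔐) n) → ∀ s t →
              Sat 𝔐 (s ≐ t) ρ ⇔ Sat 𝔑 (s ≐ t) (Vec.map (Emb.map σ) ρ)
    ≐-embed ρ s t = subst₂ (λ x y → _ ⇔ (x ≡ y))
      (sym (evalTerm-embed ρ s)) (sym (evalTerm-embed ρ t))
      (mk⇔ (cong (Emb.map σ)) (Emb.injective σ))

    rel-embed : (ρ : Vec (Carrier 𝔐) n) → ∀ R ts →
                Sat 𝔐 (rel R ts) ρ ⇔ Sat 𝔑 (rel R ts) (Vec.map (Emb.map σ) ρ)
    rel-embed ρ R ts = Emb.preserves σ R ⟨⇔⟩ ≡⇒⇔ (relation 𝔑 R)
      (trans (sym (Vec.map-∘ _ _ ts)) (Vec.map-cong (sym ∘ evalTerm-embed ρ) ts))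

  Sat-qf : {φ : Formula L n} → QuantifierFree φ → ∀ ρ →
           Sat 𝔐 φ ρ ⇔ Sat 𝔑 φ (Vec.map (Emb.map σ) ρ)
  Sat-qf (s ≐ t)    ρ = ≐-embed ρ s t
  Sat-qf (rel R ts) ρ = rel-embed ρ R ts
  Sat-qf (∼ p)      ρ = ¬-⇔ (Sat-qf p ρ)
  Sat-qf (p ∧ q)    ρ = Sat-qf p ρ ×-⇔ Sat-qf q ρ
  Sat-qf (p ∨ q)    ρ = Sat-qf p ρ ⊎-⇔ Sat-qf q ρ

  Sat-existential : {φ : Formula L n} → Existential φ → ∀ {ρ} →
                    Sat 𝔐 φ ρ → Sat 𝔑 φ (Vec.map (Emb.map σ) ρ)
  Sat-existential (qf p) s       = to (Sat-qf p _) s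
  Sat-existential (ex p) (a , s) = Emb.map σ a , Sat-existential p s

  Sat-iso : IsIsomorphism σ → (φ : Formula L n) → ∀ ρ →
            Sat 𝔐 φ ρ ⇔ Sat 𝔑 φ (Vec.map (Emb.map σ) ρ)
  Sat-iso sur (s ≐ t)    ρ = ≐-embed ρ s t
  Sat-iso sur (rel R ts) ρ = rel-embed ρ R ts
  Sat-iso sur (∼ φ)      ρ = ¬-⇔ (Sat-iso sur φ ρ)
  Sat-iso sur (φ ∧ ψ)    ρ = Sat-iso sur φ ρ ×-⇔ Sat-iso sur ψ ρ
  Sat-iso sur (φ ∨ ψ)    ρ = Sat-iso sur φ ρ ⊎-⇔ Sat-iso sur ψ ρ
  Sat-iso sur (all φ)    ρ = mk⇔
    (λ s b → let (a , eq) = sur b in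
      subst (λ b → Sat 𝔑 φ (b ∷ _)) (eq refl) (to (Sat-iso sur φ (a ∷ ρ)) (s a)))
    (λ s a → from (Sat-iso sur φ (a ∷ ρ)) (s (Emb.map σ a)))
  Sat-iso sur (ex φ)     ρ = mk⇔
    (λ (a , s) → Emb.map σ a , to (Sat-iso sur φ (a ∷ ρ)) s)
    (λ (b , s) → let (a , eq) = sur b in
      a , from (Sat-iso sur φ (a ∷ ρ)) (subst (λ b → Sat 𝔑 φ (b ∷ _)) (sym (eq refl)) s))

-- Automorphisms and orbits of tuples

module _ {𝔐 : Structure L} where

  infixr 9 _⨾_

  _⨾_ : Embedding 𝔐 𝔐 → Embedding 𝔐 𝔐 → Embedding 𝔐 𝔐
  _⨾_ = Monoid._∙_ (Emb 𝔐)

  Aut-⨾ : ∀ {σ τ} → σ ∈ Aut 𝔐 → τ ∈ Aut 𝔐 → (σ ⨾ τ) ∈ Aut 𝔐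
  Aut-⨾ {σ} {τ} σ-sur τ-sur z =
    let (y , eq) = τ-sur z ; (x , eq′) = σ-sur y in
    x , λ { refl → eq (eq′ refl) }

  inverse : (σ : Embedding 𝔐 𝔐) → σ ∈ Aut 𝔐 → Embedding 𝔐 𝔐
  inverse σ sur = record
    { map       = σ⁻¹
    ; injective = λ {x} {y} eq → trans (sym (σσ⁻¹ x)) (trans (cong (Emb.map σ) eq) (σσ⁻¹ y))
    ; preserves = λ R {xs} → ⇔-sym (Emb.preserves σ R ⟨⇔⟩ ≡⇒⇔ (relation 𝔐 R)
        (trans (sym (Vec.map-∘ _ _ xs)) (trans (Vec.map-cong σσ⁻¹ xs) (Vec.map-id xs))))
    ; fixes     = λ c → Emb.injective σ (trans (σσ⁻¹ _) (sym (Emb.fixes σ c)))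
    }
    where
    σ⁻¹ : Carrier 𝔐 → Carrier 𝔐
    σ⁻¹ y = proj₁ (sur y)
    σσ⁻¹ : ∀ y → Emb.map σ (σ⁻¹ y) ≡ y
    σσ⁻¹ y = proj₂ (sur y) refl

  inverseʳ : ∀ σ sur x → Emb.map (inverse σ sur) (Emb.map σ x) ≡ x
  inverseʳ σ sur x = Emb.injective σ (proj₂ (sur _) refl)

  inverse-Aut : ∀ σ sur → inverse σ sur ∈ Aut 𝔐
  inverse-Aut σ sur x = Emb.map σ x , λ { refl → inverseʳ σ sur x }

  Conjugate : Vec (Carrier 𝔐) n → Pred (Vec (Carrier 𝔐) n) 0ℓ
  Conjugate xs ys = ∃ λ γ → γ ∈ Aut 𝔐 × Vec.map (Emb.map γ) xs ≡ ys

  Conjugate-sym : {xs ys : Vec (Carrier 𝔐) n} → Conjugate xs ys → Conjugate ys xs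
  Conjugate-sym {xs = xs} (γ , sur , refl) = inverse γ sur , inverse-Aut γ sur ,
    trans (sym (Vec.map-∘ _ _ xs)) (trans (Vec.map-cong (inverseʳ γ sur) xs) (Vec.map-id xs))

  Conjugate-trans : {xs ys zs : Vec (Carrier 𝔐) n} →
                    Conjugate xs ys → Conjugate ys zs → Conjugate xs zs
  Conjugate-trans {xs = xs} (γ , γ-sur , refl) (δ , δ-sur , refl) =
    γ ⨾ δ , Aut-⨾ {σ = γ} {τ = δ} γ-sur δ-sur , Vec.map-∘ _ _ xs

FiniteOrbits : Structure L → Set
FiniteOrbits 𝔐 = ∀ n → ∃ λ (reps : List (Vec (Carrier 𝔐) n)) →
  ∀ xs → Any (λ r → Conjugate {𝔐 = 𝔐} r xs) reps

-- Used for the class of all formulas, where types are compared by automorphisms,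
-- and for the existential formulas, where they are compared by embeddings.

record FormulaClass (𝔐 : Structure L) : Set₁ where
  field
    class     : ∀ {n} → Pred (Formula L n) 0ℓ
    ⊇-qf      : {φ : Formula L n} → QuantifierFree φ → φ ∈ class
    rename-cl : {f : Fin m → Fin n} {φ : Formula L m} → φ ∈ class → rename f φ ∈ class
    ex-cl     : {φ : Formula L (suc n)} → φ ∈ class → ex φ ∈ class
    ∧-cl      : {φ ψ : Formula L n} → φ ∈ class → ψ ∈ class →
                ∃ λ χ → χ ∈ class × (∀ ρ → Sat 𝔐 χ ρ ⇔ (Sat 𝔐 φ ρ × Sat 𝔐 ψ ρ))

allFormulas : (𝔐 : Structure L) → FormulaClass 𝔐
allFormulas 𝔐 = record
  { class     = λ _ → ⊤
  ; ⊇-qf      = λ _ → tt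
  ; rename-cl = λ _ → tt
  ; ex-cl     = λ _ → tt
  ; ∧-cl      = λ {_} {φ} {ψ} _ _ → φ ∧ ψ , tt , λ ρ → ⇔-id _
  }

-- Prenex forms of conjunctions and disjunctions

module Prenex (𝔐 : Structure L)
  (_⊛_ : ∀ {n} → Formula L n → Formula L n → Formula L n)
  (_⊕_ : Set → Set → Set)
  (⊛-qf : ∀ {n} {φ ψ : Formula L n} → QuantifierFree φ → QuantifierFree ψ → QuantifierFree (φ ⊛ ψ))
  (Sat-⊛ : ∀ {n} (φ ψ : Formula L n) ρ → Sat 𝔐 (φ ⊛ ψ) ρ ⇔ (Sat 𝔐 φ ρ ⊕ Sat 𝔐 ψ ρ))
  (⊕-cong : ∀ {P P′ Q Q′} → P ⇔ P′ → Q ⇔ Q′ → (P ⊕ Q) ⇔ (P′ ⊕ Q′))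
  (∃-distribˡ : ∀ {P : Set} {Q : Carrier 𝔐 → Set} → (∃ λ a → P ⊕ Q a) ⇔ (P ⊕ ∃ Q))
  (∃-distribʳ : ∀ {P : Carrier 𝔐 → Set} {Q : Set} → (∃ λ a → P a ⊕ Q) ⇔ (∃ P ⊕ Q))
  where

  weaken : (φ : Formula L n) → ∀ {a ρ} → Sat 𝔐 (rename suc φ) (a ∷ ρ) ⇔ Sat 𝔐 φ ρ
  weaken φ = Sat-rename 𝔐 (λ x → refl) φ

  combineʳ : {φ ψ : Formula L n} → QuantifierFree φ → Existential ψ →
             ∃ λ χ → Existential χ × (∀ ρ → Sat 𝔐 χ ρ ⇔ (Sat 𝔐 φ ρ ⊕ Sat 𝔐 ψ ρ))
  combineʳ p (qf q) = _ , qf (⊛-qf p q) , Sat-⊛ _ _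
  combineʳ {φ = φ} p (ex q) =
    let (χ , χ-ex , sat) = combineʳ (rename-qf {f = suc} p) q in
    ex χ , ex χ-ex , λ ρ →
      ∃-⇔ (λ a → sat (a ∷ ρ) ⟨⇔⟩ ⊕-cong (weaken φ) (⇔-id _)) ⟨⇔⟩ ∃-distribˡ

  combine : {φ ψ : Formula L n} → Existential φ → Existential ψ →
            ∃ λ χ → Existential χ × (∀ ρ → Sat 𝔐 χ ρ ⇔ (Sat 𝔐 φ ρ ⊕ Sat 𝔐 ψ ρ))
  combine (qf p) q = combineʳ p q
  combine {ψ = ψ} (ex p) q =
    let (χ , χ-ex , sat) = combine p (rename-existential {f = suc} q) in
    ex χ , ex χ-ex , λ ρ →
      ∃-⇔ (λ a → sat (a ∷ ρ) ⟨⇔⟩ ⊕-cong (⇔-id _) (weaken ψ)) ⟨⇔⟩ ∃-distribʳ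

module _ (𝔐 : Structure L) where

  existential-∧ : {φ ψ : Formula L n} → Existential φ → Existential ψ →
                  ∃ λ χ → Existential χ × (∀ ρ → Sat 𝔐 χ ρ ⇔ (Sat 𝔐 φ ρ × Sat 𝔐 ψ ρ))
  existential-∧ = Prenex.combine 𝔐 _∧_ _×_ _∧_ (λ _ _ _ → ⇔-id _) _×-⇔_
    (mk⇔ (λ (a , p , q) → p , a , q) (λ (p , a , q) → a , p , q))
    (mk⇔ (λ (a , p , q) → (a , p) , q) (λ ((a , p) , q) → a , p , q))

  -- `x₀` is the value given to a quantifier pulled out of one disjunct when it is the other one
  -- that holds.
  existential-∨ : Carrier 𝔐 → {φ ψ : Formula L n} → Existential φ → Existential ψ →
                  ∃ λ χ → Existential χ × (∀ ρ → Sat 𝔐 χ ρ ⇔ (Sat 𝔐 φ ρ ⊎ Sat 𝔐 ψ ρ))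
  existential-∨ x₀ = Prenex.combine 𝔐 _∨_ _⊎_ _∨_ (λ _ _ _ → ⇔-id _) _⊎-⇔_
    (mk⇔ (λ { (a , inj₁ p) → inj₁ p ; (a , inj₂ q) → inj₂ (a , q) })
         (λ { (inj₁ p) → x₀ , inj₁ p ; (inj₂ (a , q)) → a , inj₂ q }))
    (mk⇔ (λ { (a , inj₁ p) → inj₁ (a , p) ; (a , inj₂ q) → inj₂ q })
         (λ { (inj₁ (a , p)) → a , inj₁ p ; (inj₂ q) → x₀ , inj₂ q }))

  existentialFormulas : FormulaClass 𝔐
  existentialFormulas = record
    { class     = Existential
    ; ⊇-qf      = qf
    ; rename-cl = rename-existential
    ; ex-cl     = ex
    ; ∧-cl      = existential-∧
    }

-- The Rasiowa–Sikorski lemma; the conditions are the finite lists satisfying P,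
-- ordered by inclusion, and t stands for the dense set D t.

module _ {X T : Set} (P : Pred (List X) 0ℓ) (D : T → Pred (List X) 0ℓ)
  (D-mono : ∀ t {zs ws} → zs ⊆ₗ ws → D t zs → D t ws)
  (tasks : ℕ → List T) (tasks-complete : ∀ t → ∃ λ N → t ∈ₗ tasks N)
  (dense : ∀ t {zs} → P zs → ∃ λ ws → zs ⊆ₗ ws × P ws × D t ws)
  where

  private
    meetAll : ∀ ts {zs} → P zs → ∃ λ ws → zs ⊆ₗ ws × P ws × All (λ t → D t ws) ts
    meetAll [] p = _ , id , p , []
    meetAll (t ∷ ts) p =
      let (ws , zs⊆ws , p′ , ds)  = meetAll ts p
          (vs , ws⊆vs , p″ , d) = dense t p′
      in vs , (λ z∈ → ws⊆vs (zs⊆ws z∈)) , p″ , d ∷ All.map (D-mono _ ws⊆vs) ds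

  generic : (∀ {zs ws} → zs ⊆ₗ ws → P ws → P zs) → ∀ {zs₀} → P zs₀ →
            ∃ λ (G : Pred X 0ℓ) → All G zs₀ × (∀ t → ∃ λ zs → All G zs × D t zs) ×
              (∀ zs → All G zs → P zs)
  generic P-anti {zs₀} p₀ = G , All.tabulate (λ z∈ → 0 , z∈) , met , λ zs g →
      let (k , zs⊆) = bounded zs g in P-anti (All.lookup zs⊆) (proj₂ (chain k))
    where
    chain : ℕ → ∃ P
    chain zero    = zs₀ , p₀
    chain (suc k) = let (ws , _ , p , _) = meetAll (tasks k) (proj₂ (chain k)) in ws , p

    chain-suc : ∀ k → proj₁ (chain k) ⊆ₗ proj₁ (chain (suc k))
    chain-suc k = proj₁ (proj₂ (meetAll (tasks k) (proj₂ (chain k))))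

    chain-+ : ∀ k d → proj₁ (chain k) ⊆ₗ proj₁ (chain (d + k))
    chain-+ k zero    = id
    chain-+ k (suc d) = chain-suc (d + k) ∘ chain-+ k d

    chain-mono : ∀ {k l} → k ≤ l → proj₁ (chain k) ⊆ₗ proj₁ (chain l)
    chain-mono {k} {l} k≤l =
      subst (λ l → proj₁ (chain k) ⊆ₗ proj₁ (chain l)) (ℕ.m∸n+n≡m k≤l) (chain-+ k (l ∸ k))

    G : Pred X 0ℓ
    G x = ∃ λ k → x ∈ₗ proj₁ (chain k)

    met : ∀ t → ∃ λ zs → All G zs × D t zs
    met t = let (N , t∈) = tasks-complete t in
      proj₁ (chain (suc N)) , All.tabulate (suc N ,_) ,
      All.lookup (proj₂ (proj₂ (proj₂ (meetAll (tasks N) (proj₂ (chain N)))))) t∈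

    bounded : ∀ zs → All G zs → ∃ λ k → All (_∈ₗ proj₁ (chain k)) zs
    bounded []       []             = 0 , []
    bounded (z ∷ zs) ((k , z∈) ∷ g) =
      let (l , zs⊆) = bounded zs g in
      k ⊔ l , chain-mono (ℕ.m≤m⊔n k l) z∈ ∷ All.map (chain-mono (ℕ.m≤n⊔m k l)) zs⊆

-- Finite partial maps

map-zip : {X : Set} {f : X → X} (xs ys : Vec X n) →
          All (λ (a , b) → f a ≡ b) (Vec.toList (Vec.zip xs ys)) → Vec.map f xs ≡ ys
map-zip []       []       []         = refl
map-zip (x ∷ xs) (y ∷ ys) (eq ∷ eqs) = cong₂ _∷_ eq (map-zip xs ys eqs)

module _ (em : ExcludedMiddle 0ℓ) (𝔐 : Structure L) where

  private
    M = Carrier 𝔐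

  Preserves : (∀ {n} → Pred (Formula L n) 0ℓ) → Pred (M × M) 0ℓ → Set
  Preserves K G = ∀ {n} (φ : Formula L n) → φ ∈ K → (ws : Vec (M × M) n) → VecAll G ws →
                  Sat 𝔐 φ (Vec.map proj₁ ws) → Sat 𝔐 φ (Vec.map proj₂ ws)

  module _ {G : Pred (M × M) 0ℓ} (total : ∀ a → ∃ λ b → G (a , b))
           (G-qf : Preserves QuantifierFree G) where

    private
      g : M → M
      g = proj₁ ∘ total

      graph : Vec M n → Vec (M × M) n
      graph = Vec.map (λ x → x , g x)

      graph⊆G : (xs : Vec M n) → VecAll G (graph xs)
      graph⊆G []       = []
      graph⊆G (x ∷ xs) = proj₂ (total x) ∷ graph⊆G xs

      g-qf : {φ : Formula L n} → QuantifierFree φ → ∀ xs → Sat 𝔐 φ xs → Sat 𝔐 φ (Vec.map g xs)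
      g-qf {φ = φ} p xs s = subst (Sat 𝔐 φ) (sym (Vec.map-∘ proj₂ (λ x → x , g x) xs))
        (G-qf φ p (graph xs) (graph⊆G xs)
          (subst (Sat 𝔐 φ) (trans (sym (Vec.map-id xs)) (Vec.map-∘ proj₁ (λ x → x , g x) xs)) s))

      -- Negation stays within the quantifier-free formulas, so preservation gives reflection.
      g-qf⁻ : {φ : Formula L n} → QuantifierFree φ → ∀ xs → Sat 𝔐 φ (Vec.map g xs) → Sat 𝔐 φ xs
      g-qf⁻ p xs s = decidable-stable em λ ¬s → g-qf (∼ p) xs ¬s s

      Sat-rel : ∀ R (xs : Vec M (arity L R)) →
                Sat 𝔐 (rel R (Vec.map var (Vec.allFin _))) xs ⇔ relation 𝔐 R xs
      Sat-rel R xs = ≡⇒⇔ (relation 𝔐 R)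
        (trans (sym (Vec.map-∘ _ _ (Vec.allFin _))) (Vec.map-lookup-allFin xs))

    functional : ∀ {a b b′} → G (a , b) → G (a , b′) → b ≡ b′
    functional {a} {b} {b′} h h′ =
      G-qf _ (var zero ≐ var (suc zero)) ((a , b) ∷ (a , b′) ∷ []) (h ∷ h′ ∷ []) refl

    graphEmbedding : ∃ λ (σ : Embedding 𝔐 𝔐) → ∀ {a b} → G (a , b) → Emb.map σ a ≡ b
    graphEmbedding = record
      { map       = g
      ; injective = g-qf⁻ (var zero ≐ var (suc zero)) (_ ∷ _ ∷ [])
      ; preserves = λ R {xs} → ⇔-sym (Sat-rel R xs) ⟨⇔⟩
          mk⇔ (g-qf (rel R _) xs) (g-qf⁻ (rel R _) xs) ⟨⇔⟩ Sat-rel R (Vec.map g xs)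
      ; fixes     = λ c → g-qf (var zero ≐ const c) (_ ∷ []) refl
      } , functional (proj₂ (total _))

  module _ (K : FormulaClass 𝔐) where
    open FormulaClass K

    -- Isolation is among tuples of the given structure. For a class without negations it gives one
    -- inclusion only: `d` may satisfy more formulas of the class than `c`.
    IsolatedBy : Vec M n → Formula L n → Set
    IsolatedBy c ψ = ψ ∈ class × Sat 𝔐 ψ c ×
      (∀ d → Sat 𝔐 ψ d → ∀ φ → φ ∈ class → Sat 𝔐 φ c → Sat 𝔐 φ d)

  private
    index : ∀ {m} (zs : Vec (M × M) m) {z} → z ∈ₗ Vec.toList zs → ∃ λ i → Vec.lookup zs i ≡ z
    index (z ∷ zs) (here eq)  = zero , sym eq
    index (z ∷ zs) (there z∈) = let (i , eq) = index zs z∈ in suc i , eq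

    indices : (zs : Vec (M × M) m) (ws : Vec (M × M) n) → VecAll (_∈ₗ Vec.toList zs) ws →
              ∃ λ (f : Fin n → Fin m) → ∀ x → Vec.lookup zs (f x) ≡ Vec.lookup ws x
    indices zs ws ws⊆ = (λ x → proj₁ (index zs (VecAll.lookup⁺ ws⊆ x))) ,
                        (λ x → proj₂ (index zs (VecAll.lookup⁺ ws⊆ x)))

  module PartialMaps (K : FormulaClass 𝔐) where
    open FormulaClass K

    Preserving : Pred (List (M × M)) 0ℓ
    Preserving zs = Preserves class (_∈ₗ zs)

    -- A tuple drawn from `zs` only reorders and repeats its entries; renaming the variables makes
    -- its formula one about all of `zs`.
    preserving : (zs : Vec (M × M) m) →
                 (∀ φ → φ ∈ class → Sat 𝔐 φ (Vec.map proj₁ zs) → Sat 𝔐 φ (Vec.map proj₂ zs)) →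
                 Preserving (Vec.toList zs)
    preserving zs pres φ φ∈ ws ws⊆ =
      let (f , eq) = indices zs ws ws⊆ in
      to (Sat-rename 𝔐 (lookup-cong proj₂ eq) φ) ∘ pres _ (rename-cl φ∈)
        ∘ from (Sat-rename 𝔐 (lookup-cong proj₁ eq) φ)
      where
      lookup-cong : (p : M × M → M) {f : Fin _ → Fin _} →
                    (∀ x → Vec.lookup zs (f x) ≡ Vec.lookup ws x) →
                    ∀ x → Vec.lookup (Vec.map p zs) (f x) ≡ Vec.lookup (Vec.map p ws) x
      lookup-cong p {f} eq x = trans (Vec.lookup-map (f x) p zs)
        (trans (cong p (eq x)) (sym (Vec.lookup-map x p ws)))

    preserving-zip : (xs ys : Vec M m) → (∀ φ → φ ∈ class → Sat 𝔐 φ xs → Sat 𝔐 φ ys) →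
                     Preserving (Vec.toList (Vec.zip xs ys))
    preserving-zip xs ys pres = preserving (Vec.zip xs ys) λ φ φ∈ →
      subst (Sat 𝔐 φ) (sym (Vec.map-proj₂-zip xs ys)) ∘ pres φ φ∈
        ∘ subst (Sat 𝔐 φ) (Vec.map-proj₁-zip xs ys)

    preserves-list : ∀ {zs} → Preserving zs → ∀ {φ} → φ ∈ class →
                     Sat 𝔐 φ (Vec.map proj₁ (Vec.fromList zs)) → Sat 𝔐 φ (Vec.map proj₂ (Vec.fromList zs))
    preserves-list {zs} pres φ∈ = pres _ φ∈ (Vec.fromList zs) (VecAll.fromList⁺ (All.tabulate id))

    Preserving-anti : ∀ {zs ws} → zs ⊆ₗ ws → Preserving ws → Preserving zs
    Preserving-anti zs⊆ws pres φ φ∈ us us⊆ = pres φ φ∈ us (VecAll.map zs⊆ws us⊆)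

    Preserves-finitary : (G : Pred (M × M) 0ℓ) → (∀ zs → All G zs → Preserving zs) →
                         Preserves QuantifierFree G
    Preserves-finitary G pres φ p ws ws⊆G =
      pres (Vec.toList ws) (VecAll.toList⁺ ws⊆G) φ (⊇-qf p) ws (VecAll.toList⁻ (All.tabulate id))

    module _ (isolate : ∀ {n} (c : Vec M n) → ∃ (IsolatedBy K c)) where

      -- If `ψ` isolates the type of `a` together with the domain, then `ex ψ` is in the class and
      -- is preserved; any witness `b` on the other side inherits every formula of the class.
      forth : ∀ {zs} → Preserving zs → ∀ a → ∃ λ b → Preserving ((a , b) ∷ zs)
      forth {zs} pres a =
        let (ψ , ψ∈ , ψ-a , iso) = isolate (a ∷ Vec.map proj₁ (Vec.fromList zs))
            (b , ψ-b) = preserves-list pres (ex-cl ψ∈) (a , ψ-a)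
        in b , subst (λ us → Preserving ((a , b) ∷ us)) (Vec.toList∘fromList zs)
                 (preserving ((a , b) ∷ Vec.fromList zs) (iso _ ψ-b))

      module _ (e : ℕ → M) (e-surjective : ∀ a → ∃ λ k → e k ≡ a) where

        extendToEmbedding : ∀ {zs} → Preserving zs →
                            ∃ λ (σ : Embedding 𝔐 𝔐) → All (λ (a , b) → Emb.map σ a ≡ b) zs
        extendToEmbedding {zs} pres =
          let (G , zs⊆G , met , G-pres) = generic Preserving (λ a ws → ∃ λ b → (a , b) ∈ₗ ws)
                (λ a zs⊆ws (b , ab∈) → b , zs⊆ws ab∈)
                (λ k → e k ∷ []) (λ a → let (k , eq) = e-surjective a in k , here (sym eq))
                (λ a pres → let (b , pres′) = forth pres a in _ , there , pres′ , b , here refl)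
                Preserving-anti {zs} pres
              (σ , σ-graph) = graphEmbedding {G = G}
                (λ a → let (ws , ws⊆G , b , ab∈) = met a in b , All.lookup ws⊆G ab∈)
                (Preserves-finitary G G-pres)
          in σ , All.map σ-graph zs⊆G

  open PartialMaps (allFormulas 𝔐)

  private
    -- With all formulas in the class, preserving `∼ φ` amounts to reflecting `φ`. This is why
    -- `back` is `forth` for the swapped pairs.
    Preserving-swap : ∀ {zs} → Preserving zs → Preserving (List.map Product.swap zs)
    Preserving-swap {zs} pres φ _ ws ws⊆ s = decidable-stable em λ ¬s →
      pres (∼ φ) tt (Vec.map Product.swap ws) (VecAll.map⁺ (VecAll.map unswap ws⊆))
        (subst (λ v → ¬ Sat 𝔐 φ v) (Vec.map-∘ proj₁ Product.swap ws) ¬s)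
        (subst (Sat 𝔐 φ) (Vec.map-∘ proj₂ Product.swap ws) s)
      where
      unswap : ∀ {z} → z ∈ₗ List.map Product.swap zs → Product.swap z ∈ₗ zs
      unswap z∈ with _ , z′∈ , refl ← ∈ₗ.∈-map⁻ Product.swap z∈ = z′∈

  module _ (isolate : ∀ {n} (c : Vec M n) → ∃ (IsolatedBy (allFormulas 𝔐) c))
           (e : ℕ → M) (e-surjective : ∀ a → ∃ λ k → e k ≡ a) where

    private
      back : ∀ {zs} → Preserving zs → ∀ b → ∃ λ a → Preserving ((a , b) ∷ zs)
      back {zs} pres b =
        let (a , pres′) = forth isolate {List.map Product.swap zs} (Preserving-swap {zs} pres) b
        in a , subst (λ ws → Preserving ((a , b) ∷ ws))
                 (trans (sym (List.map-∘ zs)) (List.map-id zs))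
                 (Preserving-swap {(b , a) ∷ List.map Product.swap zs} pres′)

      Task = M ⊎ M

      Done : Task → Pred (List (M × M)) 0ℓ
      Done (inj₁ a) zs = ∃ λ b → (a , b) ∈ₗ zs
      Done (inj₂ b) zs = ∃ λ a → (a , b) ∈ₗ zs

      tasks : ℕ → List Task
      tasks k = inj₁ (e k) ∷ inj₂ (e k) ∷ []

      tasks-complete : ∀ t → ∃ λ k → t ∈ₗ tasks k
      tasks-complete (inj₁ a) = let (k , eq) = e-surjective a in k , here (cong inj₁ (sym eq))
      tasks-complete (inj₂ b) = let (k , eq) = e-surjective b in k , there (here (cong inj₂ (sym eq)))

      Done-mono : ∀ t {zs ws} → zs ⊆ₗ ws → Done t zs → Done t ws
      Done-mono (inj₁ a) zs⊆ws (b , z∈) = b , zs⊆ws z∈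
      Done-mono (inj₂ b) zs⊆ws (a , z∈) = a , zs⊆ws z∈

      dense : ∀ t {zs} → Preserving zs → ∃ λ ws → zs ⊆ₗ ws × Preserving ws × Done t ws
      dense (inj₁ a) {zs} pres =
        let (b , pres′) = forth isolate {zs} pres a in (a , b) ∷ zs , there , pres′ , b , here refl
      dense (inj₂ b) {zs} pres =
        let (a , pres′) = back {zs} pres b in (a , b) ∷ zs , there , pres′ , a , here refl

    extendToAutomorphism : ∀ {zs} → Preserving zs →
      ∃ λ (σ : Embedding 𝔐 𝔐) → σ ∈ Aut 𝔐 × All (λ (a , b) → Emb.map σ a ≡ b) zs
    extendToAutomorphism {zs} pres =
      let (G , zs⊆G , met , G-pres) = generic Preserving Done Done-mono tasks tasks-complete
            (λ t {zs} → dense t {zs}) Preserving-anti {zs} pres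
          (σ , σ-graph) = graphEmbedding {G = G}
            (λ a → let (ws , ws⊆G , b , ab∈) = met (inj₁ a) in b , All.lookup ws⊆G ab∈)
            (Preserves-finitary G G-pres)
      in σ
       , (λ b → let (ws , ws⊆G , a , ab∈) = met (inj₂ b) in
            a , λ { refl → σ-graph (All.lookup ws⊆G ab∈) })
       , All.map σ-graph zs⊆G

-- Countability of the set of formulas

-- Terms and immediate subformulas may first be listed at different stages; membership at all later
-- stages lets them be combined at a common one.
Eventually : (ℕ → Set) → Set
Eventually P = ∃ λ N₀ → ∀ N → N₀ ≤ N → P N

eventually-map : {P Q : ℕ → Set} → (∀ {N} → P N → Q N) → Eventually P → Eventually Q
eventually-map f (N₀ , p) = N₀ , λ N N₀≤N → f (p N N₀≤N)

eventually-× : {P Q : ℕ → Set} → Eventually P → Eventually Q → Eventually (λ N → P N × Q N)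
eventually-× (N₀ , p) (N₁ , q) = N₀ ⊔ N₁ , λ N ≤N →
  p N (ℕ.m⊔n≤o⇒m≤o N₀ N₁ ≤N) , q N (ℕ.m⊔n≤o⇒n≤o N₀ N₁ ≤N)

eventually-suc : {P Q : ℕ → Set} → (∀ {N} → P N → Q (suc N)) → Eventually P → Eventually Q
eventually-suc f (N₀ , p) = suc N₀ , λ { (suc N) (s≤s N₀≤N) → f (p N N₀≤N) }

eventually-VecAll : {X : Set} {P : ℕ → X → Set} → (∀ x → Eventually (λ N → P N x)) →
                    (xs : Vec X n) → Eventually (λ N → VecAll (P N) xs)
eventually-VecAll p []       = 0 , λ _ _ → []
eventually-VecAll p (x ∷ xs) =
  eventually-map (λ (q , qs) → q ∷ qs) (eventually-× (p x) (eventually-VecAll p xs))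

vecs : {X : Set} → List X → ∀ k → List (Vec X k)
vecs xs zero    = [] ∷ []
vecs xs (suc k) = cartesianProductWith _∷_ xs (vecs xs k)

vecs-complete : {X : Set} {xs : List X} {v : Vec X n} → VecAll (_∈ₗ xs) v → v ∈ₗ vecs xs n
vecs-complete []       = here refl
vecs-complete (p ∷ ps) = ∈ₗ.∈-cartesianProductWith⁺ _∷_ p (vecs-complete ps)

upTo-eventually : ∀ k → Eventually (λ N → k ∈ₗ upTo N)
upTo-eventually k = suc k , λ N → ∈ₗ.∈-upTo⁺

-- (n , φ , k₁ ∷ … ∷ kₙ) is φ with the variables x_{k₁}, …, x_{kₙ} among x₀, x₁, …;
-- an assignment of these is a map from ℕ.
Item : Signature → Set
Item L = ∃ λ n → Formula L n × Vec ℕ n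

module Enumeration (em : ExcludedMiddle 0ℓ) (L : Signature) where

  private
    preimage : {X : Set} → X ↣ ℕ → ℕ → List X
    preimage {X} c k with em {∃ λ x → Injection.to c x ≡ k}
    ... | yes (x , _) = x ∷ []
    ... | no _        = []

    preimage-complete : {X : Set} (c : X ↣ ℕ) → ∀ x → x ∈ₗ preimage c (Injection.to c x)
    preimage-complete c x with em {∃ λ y → Injection.to c y ≡ Injection.to c x}
    ... | yes (y , eq) = here (sym (Injection.injective c eq))
    ... | no ¬p        = contradiction (x , refl) ¬p

  below : {X : Set} → X ↣ ℕ → ℕ → List X
  below c N = concatMap (preimage c) (upTo N)

  below-eventually : {X : Set} (c : X ↣ ℕ) → ∀ x → Eventually (λ N → x ∈ₗ below c N)
  below-eventually c x = eventually-map
    (λ k∈ → ∈ₗ.∈-concatMap⁺ (preimage c) (Any.map (λ { refl → preimage-complete c x }) k∈))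
    (upTo-eventually (Injection.to c x))

  terms : ℕ → ∀ n → List (Term L n)
  terms N n = List.map var (allFin n) ++ List.map const (below (Const-countable L) N)

  terms-eventually : (t : Term L n) → Eventually (λ N → t ∈ₗ terms N n)
  terms-eventually (var x)   = 0 , λ _ _ → ∈ₗ.∈-++⁺ˡ (∈ₗ.∈-map⁺ var (∈ₗ.∈-allFin x))
  terms-eventually (const c) = eventually-map
    (λ c∈ → ∈ₗ.∈-++⁺ʳ (List.map var (allFin _)) (∈ₗ.∈-map⁺ const c∈))
    (below-eventually (Const-countable L) c)

  rels : ℕ → ∀ n → Rel L → List (Formula L n)
  rels N n R = List.map (rel R) (vecs (terms N n) (arity L R))

  formulas : ℕ → ∀ n → List (Formula L n)
  shapes   : ℕ → ∀ n → List (List (Formula L n))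

  formulas zero    n = []
  formulas (suc N) n = concat (shapes N n)

  shapes N n =
      cartesianProductWith _≐_ (terms N n) (terms N n)
    ∷ concatMap (rels N n) (below (Rel-countable L) N)
    ∷ List.map ∼_ (formulas N n)
    ∷ cartesianProductWith _∧_ (formulas N n) (formulas N n)
    ∷ cartesianProductWith _∨_ (formulas N n) (formulas N n)
    ∷ List.map all (formulas N (suc n))
    ∷ List.map ex (formulas N (suc n))
    ∷ []

  private
    ∈-shape : ∀ N {n φ vs} → φ ∈ₗ vs → vs ∈ₗ shapes N n → φ ∈ₗ formulas (suc N) n
    ∈-shape N = ∈ₗ.∈-concat⁺′

  formulas-eventually : (φ : Formula L n) → Eventually (λ N → φ ∈ₗ formulas N n)
  formulas-eventually (s ≐ t) = eventually-suc
    (λ {N} (s∈ , t∈) → ∈-shape N (∈ₗ.∈-cartesianProductWith⁺ _≐_ s∈ t∈) (here refl))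
    (eventually-× (terms-eventually s) (terms-eventually t))
  formulas-eventually (rel R ts) = eventually-suc
    (λ {N} (R∈ , ts∈) → ∈-shape N
      (∈ₗ.∈-concatMap⁺ (rels N _) (Any.map (λ { refl → ∈ₗ.∈-map⁺ (rel R) (vecs-complete ts∈) }) R∈))
      (there (here refl)))
    (eventually-× (below-eventually (Rel-countable L) R) (eventually-VecAll terms-eventually ts))
  formulas-eventually (∼ φ) = eventually-suc
    (λ {N} φ∈ → ∈-shape N (∈ₗ.∈-map⁺ ∼_ φ∈) (there (there (here refl))))
    (formulas-eventually φ)
  formulas-eventually (φ ∧ ψ) = eventually-suc
    (λ {N} (φ∈ , ψ∈) → ∈-shape N (∈ₗ.∈-cartesianProductWith⁺ _∧_ φ∈ ψ∈)
      (there (there (there (here refl)))))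
    (eventually-× (formulas-eventually φ) (formulas-eventually ψ))
  formulas-eventually (φ ∨ ψ) = eventually-suc
    (λ {N} (φ∈ , ψ∈) → ∈-shape N (∈ₗ.∈-cartesianProductWith⁺ _∨_ φ∈ ψ∈)
      (there (there (there (there (here refl))))))
    (eventually-× (formulas-eventually φ) (formulas-eventually ψ))
  formulas-eventually (all φ) = eventually-suc
    (λ {N} φ∈ → ∈-shape N (∈ₗ.∈-map⁺ all φ∈) (there (there (there (there (there (here refl)))))))
    (formulas-eventually φ)
  formulas-eventually (ex φ) = eventually-suc
    (λ {N} φ∈ → ∈-shape N (∈ₗ.∈-map⁺ ex φ∈) (there (there (there (there (there (there (here refl))))))))
    (formulas-eventually φ)

  private
    itemsOfArity : ℕ → ℕ → List (Item L)
    itemsOfArity N n = cartesianProductWith (λ φ ks → n , φ , ks) (formulas N n) (vecs (upTo N) n)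

  items : ℕ → List (Item L)
  items N = concatMap (itemsOfArity N) (upTo N)

  tuples-eventually : (ks : Vec ℕ n) → Eventually (λ N → ks ∈ₗ vecs (upTo N) n)
  tuples-eventually ks = eventually-map vecs-complete (eventually-VecAll upTo-eventually ks)

  items-eventually : ∀ i → Eventually (λ N → i ∈ₗ items N)
  items-eventually (n , φ , ks) = eventually-map
    (λ {N} (n∈ , φ∈ , ks∈) → ∈ₗ.∈-concatMap⁺ (itemsOfArity N)
      (Any.map (λ { refl → ∈ₗ.∈-cartesianProductWith⁺ (λ φ ks → n , φ , ks) φ∈ ks∈ }) n∈))
    (eventually-× (upTo-eventually n)
      (eventually-× (formulas-eventually φ) (tuples-eventually ks)))

-- Assignments of infinitely many variables

module Items (𝔄 : Structure L) where

  private
    A = Carrier 𝔄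

  infix 4 _⊨_

  _⊨_ : (ℕ → A) → Pred (Item L) 0ℓ
  a ⊨ (n , φ , ks) = Sat 𝔄 φ (Vec.map a ks)

  AgreeBelow : ℕ → (ℕ → A) → (ℕ → A) → Set
  AgreeBelow N a a′ = ∀ {k} → k < N → a k ≡ a′ k

  agreeBelow-≤ : ∀ {M N a a′} → M ≤ N → AgreeBelow N a a′ → AgreeBelow M a a′
  agreeBelow-≤ M≤N agree k<M = agree (ℕ.<-≤-trans k<M M≤N)

  map-support : (ks : Vec ℕ n) → ∃ λ N → ∀ {a a′} → AgreeBelow N a a′ → Vec.map a ks ≡ Vec.map a′ ks
  map-support []       = 0 , λ _ → refl
  map-support (k ∷ ks) = let (N , supp) = map-support ks in
    suc k ⊔ N , λ agree → cong₂ _∷_ (agree (ℕ.m≤m⊔n (suc k) N)) (supp (agreeBelow-≤ (ℕ.m≤n⊔m (suc k) N) agree))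

  -- Finitely many items mention finitely many variables, so a later variable can be reassigned
  -- without affecting them.
  ⊨-support : ∀ Γ → ∃ λ N → ∀ {a a′} → AgreeBelow N a a′ → All (a ⊨_) Γ → All (a′ ⊨_) Γ
  ⊨-support []                 = 0 , λ _ _ → []
  ⊨-support ((_ , φ , ks) ∷ Γ) = let (M , supp) = map-support ks ; (N , supp′) = ⊨-support Γ in
    M ⊔ N , λ { agree (s ∷ ss) →
      subst (Sat 𝔄 φ) (supp (agreeBelow-≤ (ℕ.m≤m⊔n M N) agree)) s
      ∷ supp′ (agreeBelow-≤ (ℕ.m≤n⊔m M N) agree) ss }

  _[_↦_] : (ℕ → A) → ℕ → A → ℕ → A
  (a [ k ↦ d ]) j with j ℕ.≟ k
  ... | yes _ = d
  ... | no _  = a j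

  update-same : ∀ a k d → (a [ k ↦ d ]) k ≡ d
  update-same a k d with k ℕ.≟ k
  ... | yes _  = refl
  ... | no k≢k = contradiction refl k≢k

  update-below : ∀ a k d → AgreeBelow k a (a [ k ↦ d ])
  update-below a k d {j} j<k with j ℕ.≟ k
  ... | yes refl = contradiction j<k (ℕ.<-irrefl refl)
  ... | no _     = refl

-- Complete types built generically

module _ (em : ExcludedMiddle 0ℓ) where

  ¬∀⇒∃¬ : {X : Set} {P : X → Set} → ¬ (∀ x → P x) → ∃ λ x → ¬ P x
  ¬∀⇒∃¬ ¬∀ = decidable-stable em λ ¬∃ → ¬∀ λ x → decidable-stable em λ ¬p → ¬∃ (x , ¬p)

  leastBelow : (P : ℕ → Set) → ∀ N → P N → ∃ λ k → P k × (∀ {j} → P j → k ≤ j)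
  leastBelow P N p = search N (N , ℕ.≤-refl , p)
    where
    search : ∀ N → (∃ λ k → k ≤ N × P k) → ∃ λ k → P k × (∀ {j} → P j → k ≤ j)
    search zero    (zero , _ , p) = 0 , p , λ _ → z≤n
    search (suc N) (k , k≤ , p) with em {∃ λ j → j ≤ N × P j}
    ... | yes q = search N q
    ... | no ¬q = k , p , λ {j} pj → ℕ.≤-trans k≤ (ℕ.≰⇒> λ j≤N → ¬q (j , j≤N , pj))

-- Completeness and the Henkin property at once. The equation `φ ≡ ex ψ` states the witness
-- requirement without a case distinction on the formula.
Decided : Pred (Item L) 0ℓ → Item L → Set
Decided G (n , φ , ks) =
  G (n , ∼ φ , ks) ⊎
  (G (n , φ , ks) × (∀ ψ → φ ≡ ex ψ → ∃ λ k → G (suc n , ψ , k ∷ ks)))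

Decided-mono : {G H : Pred (Item L) 0ℓ} → G ⊆ H → ∀ i → Decided G i → Decided H i
Decided-mono G⊆H i (inj₁ g)       = inj₁ (G⊆H g)
Decided-mono G⊆H i (inj₂ (g , w)) = inj₂ (G⊆H g , λ ψ eq → Product.map₂ G⊆H (w ψ eq))

-- Each `Z k` is a requirement on assignments. With `Z` trivial, the generic type is merely
-- consistent in `𝔄` and is shaped by extra tasks; with `Z` excluding finite sets of orbits, each
-- finite part of it is satisfiable outside any finitely many orbits.
module GenericType (em : ExcludedMiddle 0ℓ) {L : Signature} (𝔄 : Structure L)
  {K : Set} (Z : K → Pred (ℕ → Carrier 𝔄) 0ℓ)
  (Z-directed : ∀ k l → ∃ λ m → Z m ⊆ Z k × Z m ⊆ Z l)
  (Z-support : ∃ λ N → ∀ k {a a′} → Items.AgreeBelow 𝔄 N a a′ → Z k a → Z k a′)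
  where

  open Items 𝔄

  -- Directedness of Z makes largeness a consistency property; the finite support
  -- of Z leaves fresh variables for witnesses.
  Large : Pred (List (Item L)) 0ℓ
  Large Γ = ∀ k → ∃ λ a → Z k a × All (a ⊨_) Γ

  Large-anti : ∀ {Γ Δ} → Γ ⊆ₗ Δ → Large Δ → Large Γ
  Large-anti Γ⊆Δ large k = let (a , z , s) = large k in
    a , z , All.tabulate (λ i∈ → All.lookup s (Γ⊆Δ i∈))

  -- If `φ` cannot be added, this already fails for one `k`. Below `k` and any `l` lies some `m`,
  -- and the assignment found in `Z m` must satisfy `∼ φ`.
  large-decide : ∀ {Γ} → Large Γ → (φ : Formula L n) → ∀ ks →
                 Large ((n , φ , ks) ∷ Γ) ⊎ Large ((n , ∼ φ , ks) ∷ Γ)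
  large-decide {Γ = Γ} large φ ks with em {Large ((_ , φ , ks) ∷ Γ)}
  ... | yes p = inj₁ p
  ... | no ¬p = inj₂ λ l →
    let (k , ¬k)       = ¬∀⇒∃¬ em ¬p
        (m , Zk , Zl)  = Z-directed k l
        (a , z , s)    = large m
    in a , Zl z , (λ t → ¬k (a , Zk z , t ∷ s)) ∷ s

  -- The witness `d` varies with `l`, but its variable must not. A variable beyond the supports of
  -- `ks`, `Γ` and `Z` is free to receive it.
  large-witness : ∀ {Γ} (ψ : Formula L (suc n)) ks → Large ((n , ex ψ , ks) ∷ Γ) →
                  ∃ λ k → Large ((suc n , ψ , k ∷ ks) ∷ (n , ex ψ , ks) ∷ Γ)
  large-witness {Γ = Γ} ψ ks large = k , λ l →
    let (a , z , s) = large l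
        (d , ψ-d)   = All.head s
        agree       = update-below a k d
        agree′      = agreeBelow-≤ (ℕ.m≤m⊔n (M ⊔ N) N₀) agree
    in a [ k ↦ d ]
     , Z-supp l (agreeBelow-≤ (ℕ.m≤n⊔m (M ⊔ N) N₀) agree) z
     , subst (Sat 𝔄 ψ) (cong₂ _∷_ (sym (update-same a k d))
         (ks-supp (agreeBelow-≤ (ℕ.m≤m⊔n M N) agree′))) ψ-d
     ∷ Γ-supp (agreeBelow-≤ (ℕ.m≤n⊔m M N) agree′) s
    where
    M       = proj₁ (map-support ks)
    ks-supp = λ {a a′} → proj₂ (map-support ks) {a} {a′}
    N       = proj₁ (⊨-support ((_ , ex ψ , ks) ∷ Γ))
    Γ-supp  = λ {a a′} → proj₂ (⊨-support ((_ , ex ψ , ks) ∷ Γ)) {a} {a′}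
    N₀      = proj₁ Z-support
    Z-supp  = proj₂ Z-support
    k       = (M ⊔ N) ⊔ N₀

  decide-dense : ∀ i {Γ} → Large Γ → ∃ λ Δ → Γ ⊆ₗ Δ × Large Δ × Decided (_∈ₗ Δ) i
  decide-dense (n , φ , ks) {Γ} large with large-decide large φ ks
  ... | inj₂ l = (n , ∼ φ , ks) ∷ Γ , there , l , inj₁ (here refl)
  ... | inj₁ l with em {∃ λ ψ → φ ≡ ex ψ}
  ...   | no ¬ex = (n , φ , ks) ∷ Γ , there , l ,
          inj₂ (here refl , λ ψ eq → contradiction (ψ , eq) ¬ex)
  ...   | yes (ψ , refl) = let (k , l′) = large-witness ψ ks l in
          (suc n , ψ , k ∷ ks) ∷ (n , ex ψ , ks) ∷ Γ , (λ i∈ → there (there i∈)) , l′ ,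
          inj₂ (there (here refl) , λ { _ refl → k , here refl })

  module _ {E : Set} (tasks : ℕ → List E) (tasks-complete : ∀ e → ∃ λ N → e ∈ₗ tasks N)
    (D : E → Pred (List (Item L)) 0ℓ) (D-mono : ∀ e {Γ Δ} → Γ ⊆ₗ Δ → D e Γ → D e Δ)
    (D-dense : ∀ e {Γ} → Large Γ → ∃ λ Δ → Γ ⊆ₗ Δ × Large Δ × D e Δ)
    where

    private
      open Enumeration em L using (items; items-eventually)

      allTasks : ℕ → List (Item L ⊎ E)
      allTasks N = List.map inj₁ (items N) ++ List.map inj₂ (tasks N)

      allTasks-complete : ∀ t → ∃ λ N → t ∈ₗ allTasks N
      allTasks-complete (inj₁ i) = let (N , i∈) = items-eventually i in
        N , ∈ₗ.∈-++⁺ˡ (∈ₗ.∈-map⁺ inj₁ (i∈ N ℕ.≤-refl))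
      allTasks-complete (inj₂ e) = let (N , e∈) = tasks-complete e in
        N , ∈ₗ.∈-++⁺ʳ (List.map inj₁ (items N)) (∈ₗ.∈-map⁺ inj₂ e∈)

      Done : Item L ⊎ E → Pred (List (Item L)) 0ℓ
      Done (inj₁ i) Γ = Decided (_∈ₗ Γ) i
      Done (inj₂ e) Γ = D e Γ

      Done-mono : ∀ t {Γ Δ} → Γ ⊆ₗ Δ → Done t Γ → Done t Δ
      Done-mono (inj₁ i) {Γ} {Δ} Γ⊆Δ = Decided-mono {G = _∈ₗ Γ} {H = _∈ₗ Δ} Γ⊆Δ i
      Done-mono (inj₂ e) Γ⊆Δ = D-mono e Γ⊆Δ

      dense : ∀ t {Γ} → Large Γ → ∃ λ Δ → Γ ⊆ₗ Δ × Large Δ × Done t Δ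
      dense (inj₁ i) = decide-dense i
      dense (inj₂ e) = D-dense e

    genericType : Large [] → ∃ λ (H : Pred (Item L) 0ℓ) → (∀ i → Decided H i) ×
      (∀ Γ → All H Γ → Large Γ) × (∀ e → ∃ λ Γ → All H Γ × D e Γ)
    genericType large =
      let (H , _ , met , H-large) = generic Large Done Done-mono allTasks allTasks-complete
            dense Large-anti large
      in H
       , (λ i → let (Γ , Γ⊆H , d) = met (inj₁ i) in Decided-mono {G = _∈ₗ Γ} {H = H} (All.lookup Γ⊆H) i d)
       , H-large
       , (λ e → met (inj₂ e))

-- The Henkin model of a complete type; its universe ℕ enumerates the classes
-- of variables which the type makes equal.

module HenkinModel (em : ExcludedMiddle 0ℓ) {L : Signature} (𝔄 : Structure L)
  (infinite : ℕ ↣ Carrier 𝔄) (H : Pred (Item L) 0ℓ) (decided : ∀ i → Decided H i)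
  (consistent : ∀ Γ → All H Γ → ∃ λ a → All (Items._⊨_ 𝔄 a) Γ)
  where

  open Items 𝔄

  private
    A = Carrier 𝔄

  -- Consequence in `𝔄` from a finite part of `H` replaces derivability. Arbitrary sets of
  -- assignments are allowed, so conditions such as `a k ≡ a l` can be handled without writing
  -- formulas.
  Forces : Pred (ℕ → A) 0ℓ → Set
  Forces S = ∃ λ Γ → All H Γ × (∀ a → All (a ⊨_) Γ → S a)

  forces-⊇ : {S T : Pred (ℕ → A) 0ℓ} → (∀ a → S a → T a) → Forces S → Forces T
  forces-⊇ S⊆T (Γ , Γ⊆H , f) = Γ , Γ⊆H , λ a s → S⊆T a (f a s)

  forces-true : {S : Pred (ℕ → A) 0ℓ} → (∀ a → S a) → Forces S
  forces-true s = [] , [] , λ a _ → s a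

  forces-× : {S T : Pred (ℕ → A) 0ℓ} → Forces S → Forces T → Forces (λ a → S a × T a)
  forces-× (Γ , Γ⊆H , f) (Δ , Δ⊆H , g) = Γ ++ Δ , All.++⁺ Γ⊆H Δ⊆H , λ a s →
    f a (All.++⁻ˡ Γ s) , g a (All.++⁻ʳ Γ s)

  forces-map₂ : {S T R : Pred (ℕ → A) 0ℓ} → (∀ a → S a → T a → R a) → Forces S → Forces T → Forces R
  forces-map₂ f p q = forces-⊇ (λ a (s , t) → f a s t) (forces-× p q)

  forces-consistent : {S : Pred (ℕ → A) 0ℓ} → Forces S → ∃ S
  forces-consistent (Γ , Γ⊆H , f) = let (a , s) = consistent Γ Γ⊆H in a , f a s

  forces-contradiction : {S T : Pred (ℕ → A) 0ℓ} → (∀ a → S a → T a → ⊥) → Forces S → Forces T → ⊥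
  forces-contradiction f p q = let (a , s , t) = forces-consistent (forces-× p q) in f a s t

  H⇒forces : ∀ {i} → H i → Forces (_⊨ i)
  H⇒forces h = _ ∷ [] , h ∷ [] , λ a → All.head

  forces⇒H : ∀ i → Forces (_⊨ i) → H i
  forces⇒H i f with decided i
  ... | inj₂ (h , _) = h
  ... | inj₁ h       = ⊥-elim (forces-contradiction (λ a s ¬s → ¬s s) f (H⇒forces h))

  forces-witness : (ψ : Formula L (suc n)) (ks : Vec ℕ n) → Forces (_⊨ (n , ex ψ , ks)) →
                   ∃ λ k → Forces (_⊨ (suc n , ψ , k ∷ ks))
  forces-witness ψ ks f with decided (_ , ex ψ , ks)
  ... | inj₁ h       = ⊥-elim (forces-contradiction (λ a s ¬s → ¬s s) f (H⇒forces h))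
  ... | inj₂ (_ , w) = Product.map₂ H⇒forces (w ψ refl)

  forces-decided : ∀ i → Forces (_⊨ i) ⊎ Forces (λ a → ¬ a ⊨ i)
  forces-decided i = Sum.[ inj₂ ∘ H⇒forces , inj₁ ∘ H⇒forces ∘ proj₁ ]′ (decided i)

  infix 4 _∼ₕ_

  _∼ₕ_ : ℕ → ℕ → Set
  k ∼ₕ l = H (2 , var zero ≐ var (suc zero) , k ∷ l ∷ [])

  ∼ₕ⇒forces : ∀ {k l} → k ∼ₕ l → Forces (λ a → a k ≡ a l)
  ∼ₕ⇒forces = H⇒forces

  forces⇒∼ₕ : ∀ {k l} → Forces (λ a → a k ≡ a l) → k ∼ₕ l
  forces⇒∼ₕ = forces⇒H _

  private
    distinct : List (Fin n) → Formula L (suc n)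
    distinct []       = var zero ≐ var zero
    distinct (x ∷ xs) = ∼ (var zero ≐ var (suc x)) ∧ distinct xs

    Sat-distinct : ∀ xs {d} {ρ : Vec A n} →
                   Sat 𝔄 (distinct xs) (d ∷ ρ) ⇔ All (λ x → d ≢ Vec.lookup ρ x) xs
    Sat-distinct []       = mk⇔ (λ _ → []) (λ _ → refl)
    Sat-distinct (x ∷ xs) = mk⇔ (λ (p , q) → p ∷ to (Sat-distinct xs) q)
                                (λ { (p ∷ q) → p , from (Sat-distinct xs) q })

    newElement : (ρ : Vec A n) → ∃ λ d → ∀ x → d ≢ Vec.lookup ρ x
    newElement ρ =
      let (i , i∉) = ¬∀⇒∃¬ em (∈ₗ.finite infinite (Vec.toList ρ)) in
      Injection.to infinite i , λ x eq → i∉ (subst (_∈ₗ Vec.toList ρ) (sym eq)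
        (∈ᵥ.∈-toList⁺ (∈ᵥ.∈-lookup x ρ)))

  -- Since `𝔄` is infinite, the existence of an element different from finitely many given ones is
  -- forced; its Henkin witness opens a new class. Hence there are infinitely many classes and ℕ can
  -- be the universe.
  newVariable : (ks : Vec ℕ n) → ∃ λ k → ∀ x → ¬ k ∼ₕ Vec.lookup ks x
  newVariable ks =
    let (k , f) = forces-witness (distinct (allFin _)) ks (forces-true λ a →
          let (d , new) = newElement (Vec.map a ks) in
          d , from (Sat-distinct (allFin _)) (All.tabulate λ {x} _ → new x))
    in k , λ x k∼ → forces-contradiction
      (λ a s eq → All.lookup (to (Sat-distinct (allFin _)) s) (∈ₗ.∈-allFin x)
        (trans eq (sym (Vec.lookup-map x a ks))))
      f (∼ₕ⇒forces k∼)

  private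
    abstract
      next : (ks : Vec ℕ n) → ∃ λ k → (∀ x → ¬ k ∼ₕ Vec.lookup ks x) ×
             (∀ {j} → (∀ x → ¬ j ∼ₕ Vec.lookup ks x) → k ≤ j)
      next ks = leastBelow em _ _ (proj₂ (newVariable ks))

    chosen : ∀ m → Vec ℕ m
    chosen zero    = []
    chosen (suc m) = proj₁ (next (chosen m)) ∷ chosen m

  s : ℕ → ℕ
  s m = proj₁ (next (chosen m))

  private
    chosen-lookup : ∀ m x → ∃ λ i → Vec.lookup (chosen m) x ≡ s i
    chosen-lookup (suc m) zero    = m , refl
    chosen-lookup (suc m) (suc x) = chosen-lookup m x

    lookup-chosen : ∀ {i m} → i < m → ∃ λ x → Vec.lookup (chosen m) x ≡ s i
    lookup-chosen {i} {suc m} i<1+m with ℕ.m<1+n⇒m<n∨m≡n i<1+m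
    ... | inj₂ refl = zero , refl
    ... | inj₁ i<m  = let (x , eq) = lookup-chosen i<m in suc x , eq

    s-new : ∀ {i m} → i < m → ¬ s m ∼ₕ s i
    s-new {i} {m} i<m eq = let (x , eq′) = lookup-chosen i<m in
      proj₁ (proj₂ (next (chosen m))) x (subst (s m ∼ₕ_) (sym eq′) eq)

  s-injective : ∀ {i m} → s i ∼ₕ s m → i ≡ m
  s-injective {i} {m} eq with ℕ.<-cmp i m
  ... | tri< i<m _ _ = contradiction (forces⇒∼ₕ (forces-⊇ (λ _ → sym) (∼ₕ⇒forces eq))) (s-new i<m)
  ... | tri≈ _ i≡m _ = i≡m
  ... | tri> _ _ m<i = contradiction eq (s-new m<i)

  -- A variable `k` equivalent to no `s m` would remain a candidate at every step, so minimality
  -- would bound the injective sequence `s` by `k`.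
  s-surjective : ∀ k → ∃ λ m → k ∼ₕ s m
  s-surjective k = decidable-stable em λ ¬∃ →
    ∈ₗ.finite (mk↣ {to = s} λ {i} {m} eq → s-injective (forces⇒∼ₕ (forces-true λ a → cong a eq)))
      (upTo (suc k)) λ m → ∈ₗ.∈-upTo⁺ (s≤s (proj₂ (proj₂ (next (chosen m)))
        λ x k∼ → let (i , eq) = chosen-lookup m x in ¬∃ (i , subst (k ∼ₕ_) eq k∼)))

  class : ℕ → ℕ
  class k = proj₁ (s-surjective k)

  forces-class : ∀ k → Forces (λ a → a k ≡ a (s (class k)))
  forces-class k = ∼ₕ⇒forces (proj₂ (s-surjective k))

  class-s : ∀ m → class (s m) ≡ m
  class-s m = sym (s-injective (proj₂ (s-surjective (s m))))

  private
    constantVariable : ∀ c → ∃ λ k → Forces (λ a → a k ≡ constant 𝔄 c)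
    constantVariable c = forces-witness (var zero ≐ const c) [] (forces-true λ a → constant 𝔄 c , refl)

  𝔐 : Structure L
  𝔐 = record
    { Carrier  = ℕ
    ; relation = λ R ms → Forces (λ a → relation 𝔄 R (Vec.map (a ∘ s) ms))
    ; constant = λ c → class (proj₁ (constantVariable c))
    }

  private
    term : ∀ (t : Term L n) ms →
           Forces (λ a → a (s (evalTerm 𝔐 ms t)) ≡ evalTerm 𝔄 (Vec.map (a ∘ s) ms) t)
    term (var x)   ms = forces-true λ a → sym (Vec.lookup-map x (a ∘ s) ms)
    term (const c) ms = let (k , f) = constantVariable c in
      forces-map₂ (λ a eq eq′ → trans (sym eq) eq′) (forces-class k) f

    termVec : ∀ (ts : Vec (Term L n) m) ms →
              Forces (λ a → Vec.map (a ∘ s) (Vec.map (evalTerm 𝔐 ms) ts) ≡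
                            Vec.map (evalTerm 𝔄 (Vec.map (a ∘ s) ms)) ts)
    termVec []       ms = forces-true λ a → refl
    termVec (t ∷ ts) ms = forces-map₂ (λ a → cong₂ _∷_) (term t ms) (termVec ts ms)

    Forced : Formula L n → Vec ℕ n → Set
    Forced φ ms = Forces (λ a → Sat 𝔄 φ (Vec.map (a ∘ s) ms))

    forced-item : (φ : Formula L n) → ∀ ms → Forced φ ms ⇔ Forces (_⊨ (n , φ , Vec.map s ms))
    forced-item φ ms = mk⇔
      (forces-⊇ λ a → subst (Sat 𝔄 φ) (Vec.map-∘ a s ms))
      (forces-⊇ λ a → subst (Sat 𝔄 φ) (sym (Vec.map-∘ a s ms)))

    forced-decided : (φ : Formula L n) → ∀ ms → Forced φ ms ⊎ Forced (∼ φ) ms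
    forced-decided φ ms = Sum.map (from (forced-item φ ms)) (from (forced-item (∼ φ) ms))
      (forces-decided (_ , φ , Vec.map s ms))

    forced-witness : (φ : Formula L (suc n)) → ∀ ms → Forced (ex φ) ms → ∃ λ m → Forced φ (m ∷ ms)
    forced-witness φ ms f =
      let (k , g) = forces-witness φ (Vec.map s ms) (to (forced-item (ex φ) ms) f) in
      class k , forces-map₂
        (λ a s eq → subst (Sat 𝔄 φ) (cong₂ _∷_ eq (sym (Vec.map-∘ a _ ms))) s)
        g (forces-class k)

  -- Negation and disjunction rest on `H` deciding every item, the quantifiers on its Henkin
  -- witnesses, equality on `s` choosing one variable from each class.
  truth : (φ : Formula L n) → ∀ ms → Sat 𝔐 φ ms ⇔ Forced φ ms
  truth (t ≐ u) ms = mk⇔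
    (λ eq → forces-map₂ (λ a p q → trans (sym p) (trans (cong (a ∘ s) eq) q)) (term t ms) (term u ms))
    (λ f → s-injective (forces⇒∼ₕ (forces-map₂ (λ a p (q , r) → trans q (trans p (sym r)))
      f (forces-× (term t ms) (term u ms)))))
  truth (rel R ts) ms = mk⇔
    (forces-map₂ (λ a eq → subst (relation 𝔄 R) eq) (termVec ts ms))
    (forces-map₂ (λ a eq → subst (relation 𝔄 R) (sym eq)) (termVec ts ms))
  truth (∼ φ) ms = mk⇔
    (λ ¬s → Sum.[ (λ f → contradiction (from (truth φ ms) f) ¬s) , id ]′ (forced-decided φ ms))
    (λ f t → forces-contradiction (λ a ¬s s → ¬s s) f (to (truth φ ms) t))
  truth (φ ∧ ψ) ms = mk⇔
    (λ (p , q) → forces-× (to (truth φ ms) p) (to (truth ψ ms) q))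
    (λ f → from (truth φ ms) (forces-⊇ (λ _ → proj₁) f) , from (truth ψ ms) (forces-⊇ (λ _ → proj₂) f))
  truth (φ ∨ ψ) ms = mk⇔
    Sum.[ forces-⊇ (λ _ → inj₁) ∘ to (truth φ ms) , forces-⊇ (λ _ → inj₂) ∘ to (truth ψ ms) ]′
    (λ f → Sum.map (from (truth φ ms))
      (λ ¬φ → from (truth ψ ms) (forces-map₂
        (λ a → Sum.[ (λ p ¬p → contradiction p ¬p) , (λ q _ → q) ]′) f ¬φ))
      (forced-decided φ ms))
  truth (all φ) ms = mk⇔
    (λ t → Sum.[ id , (λ f →
        let (m , ¬φ) = forced-witness (∼ φ) ms (forces-⊇ (λ a → ¬∀⇒∃¬ em) f) in
        ⊥-elim (forces-contradiction (λ a s ¬s → ¬s s) (to (truth φ (m ∷ ms)) (t m)) ¬φ)) ]′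
      (forced-decided (all φ) ms))
    (λ f m → from (truth φ (m ∷ ms)) (forces-⊇ (λ a t → t (a (s m))) f))
  truth (ex φ) ms = mk⇔
    (λ (m , t) → forces-⊇ (λ a p → a (s m) , p) (to (truth φ (m ∷ ms)) t))
    (λ f → let (m , g) = forced-witness φ ms f in m , from (truth φ (m ∷ ms)) g)

  𝔐-models : ∀ T → 𝔄 IsModelOf T → 𝔐 IsModelOf T
  𝔐-models T 𝔄⊨T φ φ∈T = from (truth φ []) (forces-true λ a → 𝔄⊨T φ φ∈T)

  -- Surjectivity is what makes omission count: every tuple of `𝔄` is named by variables, so a type
  -- that `H` omits would be omitted by `𝔄`.
  realise : 𝔐 ≅ 𝔄 → ∃ λ (v : ℕ → A) → (∀ x → ∃ λ k → v k ≡ x) × (∀ i → v ⊨ i ⇔ H i)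
  realise (h , h-surjective) = Emb.map h ∘ class
    , (λ x → let (m , eq) = h-surjective x in s m , eq (class-s m))
    , λ { i@(_ , φ , ks) →
        ≡⇒⇔ (Sat 𝔄 φ) (Vec.map-∘ _ class ks)
        ⟨⇔⟩ ⇔-sym (Sat-iso h h-surjective φ (Vec.map class ks))
        ⟨⇔⟩ truth φ (Vec.map class ks)
        ⟨⇔⟩ mk⇔ (λ f → forces⇒H i (forces-map₂ (λ a s eq → subst (Sat 𝔄 φ) (sym eq) s) f (classes ks)))
                (λ h → forces-map₂ (λ a s eq → subst (Sat 𝔄 φ) eq s) (H⇒forces h) (classes ks)) }
    where
    classes : (ks : Vec ℕ n) → Forces (λ a → Vec.map a ks ≡ Vec.map (a ∘ s) (Vec.map class ks))
    classes []       = forces-true λ a → refl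
    classes (k ∷ ks) = forces-map₂ (λ a → cong₂ _∷_) (forces-class k) (classes ks)

-- Defining the values of variables under finitely many conditions

module Projection (𝔄 : Structure L) where

  open Items 𝔄

  private
    A = Carrier 𝔄

    exs : ∀ W → Formula L (W + n) → Formula L n
    exs zero    φ = φ
    exs (suc W) φ = exs W (ex φ)

    Sat-exs : ∀ W (φ : Formula L (W + n)) d →
              Sat 𝔄 (exs W φ) d ⇔ ∃ λ (ρ : Vec A W) → Sat 𝔄 φ (ρ Vec.++ d)
    Sat-exs zero    φ d = mk⇔ (λ s → [] , s) (λ { ([] , s) → s })
    Sat-exs (suc W) φ d = Sat-exs W (ex φ) d ⟨⇔⟩
      mk⇔ (λ (ρ , x , s) → x ∷ ρ , s) (λ { (x ∷ ρ , s) → ρ , x , s })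

  module _ (N : ℕ) where

    private
      -- A nonempty window makes `mod` available and provides `var zero` for the trivially true
      -- empty conjunctions.
      W = suc N

      assignment : Vec A W → ℕ → A
      assignment ρ k = Vec.lookup ρ (k mod W)

      assignment-tabulate : ∀ a → AgreeBelow W a (assignment (Vec.tabulate (a ∘ Fin.toℕ)))
      assignment-tabulate a {k} k<W = sym (trans (Vec.lookup∘tabulate (a ∘ Fin.toℕ) (k mod W))
        (cong a (trans (Fin.toℕ-fromℕ< _) (m<n⇒m%n≡m k<W))))

      conditions : ∀ n → List (Item L) → Formula L (W + n)
      conditions n []                 = var zero ≐ var zero
      conditions n ((_ , φ , ls) ∷ Γ) =
        rename (λ x → (Vec.lookup ls x mod W) Fin.↑ˡ n) φ ∧ conditions n Γ

      Sat-conditions : ∀ Γ ρ (d : Vec A n) →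
                       Sat 𝔄 (conditions n Γ) (ρ Vec.++ d) ⇔ All (assignment ρ ⊨_) Γ
      Sat-conditions []                 ρ d = mk⇔ (λ _ → []) (λ _ → refl)
      Sat-conditions ((_ , φ , ls) ∷ Γ) ρ d =
        (Sat-rename 𝔄 (λ x → trans (Vec.lookup-++ˡ ρ d _) (sym (Vec.lookup-map x _ ls))) φ
          ×-⇔ Sat-conditions Γ ρ d)
        ⟨⇔⟩ mk⇔ (λ (s , ss) → s ∷ ss) (λ { (s ∷ ss) → s , ss })

      equations : Vec ℕ n → List (Fin n) → Formula L (W + n)
      equations ks []       = var zero ≐ var zero
      equations ks (x ∷ xs) =
        (var ((Vec.lookup ks x mod W) Fin.↑ˡ _) ≐ var (W Fin.↑ʳ x)) ∧ equations ks xs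

      Sat-equations : ∀ (ks : Vec ℕ n) xs ρ d → Sat 𝔄 (equations ks xs) (ρ Vec.++ d) ⇔
                      All (λ x → assignment ρ (Vec.lookup ks x) ≡ Vec.lookup d x) xs
      Sat-equations ks []       ρ d = mk⇔ (λ _ → []) (λ _ → refl)
      Sat-equations ks (x ∷ xs) ρ d =
        (mk⇔ (λ eq → trans (sym l) (trans eq r)) (λ eq → trans l (trans eq (sym r)))
          ×-⇔ Sat-equations ks xs ρ d)
        ⟨⇔⟩ mk⇔ (λ (s , ss) → s ∷ ss) (λ { (s ∷ ss) → s , ss })
        where
        l = Vec.lookup-++ˡ ρ d (Vec.lookup ks x mod W)
        r = Vec.lookup-++ʳ ρ d x

      map-≡ : ∀ (a : ℕ → A) (ks : Vec ℕ n) d →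
              All (λ x → a (Vec.lookup ks x) ≡ Vec.lookup d x) (allFin n) ⇔ (Vec.map a ks ≡ d)
      map-≡ a ks d = mk⇔
        (λ eqs → trans (sym (Vec.tabulate∘lookup (Vec.map a ks))) (trans
          (Vec.tabulate-cong λ x → trans (Vec.lookup-map x a ks) (All.lookup eqs (∈ₗ.∈-allFin x)))
          (Vec.tabulate∘lookup d)))
        (λ { refl → All.tabulate λ {x} _ → sym (Vec.lookup-map x a ks) })

    projectionBelow : List (Item L) → Vec ℕ n → Formula L n
    projectionBelow {n = n} Γ ks = exs W (conditions n Γ ∧ equations ks (allFin n))

    Sat-projectionBelow : ∀ Γ (ks : Vec ℕ n) →
      (∀ {a a′} → AgreeBelow W a a′ → All (a ⊨_) Γ → All (a′ ⊨_) Γ) →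
      (∀ {a a′ : ℕ → A} → AgreeBelow W a a′ → Vec.map a ks ≡ Vec.map a′ ks) →
      ∀ d → Sat 𝔄 (projectionBelow Γ ks) d ⇔ ∃ λ a → All (a ⊨_) Γ × Vec.map a ks ≡ d
    Sat-projectionBelow Γ ks Γ-supp ks-supp d =
      Sat-exs W _ d
      ⟨⇔⟩ ∃-⇔ (λ ρ → Sat-conditions Γ ρ d ×-⇔ (Sat-equations ks (allFin _) ρ d ⟨⇔⟩ map-≡ _ ks d))
      ⟨⇔⟩ mk⇔ (λ (ρ , s , eq) → assignment ρ , s , eq)
              (λ (a , s , eq) → Vec.tabulate (a ∘ Fin.toℕ)
                , Γ-supp (assignment-tabulate a) s
                , trans (sym (ks-supp (assignment-tabulate a))) eq)

  -- The supports bound the variables that matter, so quantifying over assignments reduces to a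
  -- finite block of existential quantifiers.
  projection : ∀ Γ (ks : Vec ℕ n) → ∃ λ (θ : Formula L n) →
               ∀ d → Sat 𝔄 θ d ⇔ ∃ λ a → All (a ⊨_) Γ × Vec.map a ks ≡ d
  projection Γ ks =
    let (M , Γ-supp) = ⊨-support Γ ; (N , ks-supp) = map-support ks
        M≤ = ℕ.≤-trans (ℕ.m≤m⊔n M N) (ℕ.n≤1+n _)
        N≤ = ℕ.≤-trans (ℕ.m≤n⊔m M N) (ℕ.n≤1+n _)
    in projectionBelow (M ⊔ N) Γ ks , Sat-projectionBelow (M ⊔ N) Γ ks
         (λ agree → Γ-supp (agreeBelow-≤ M≤ agree)) (λ agree → ks-supp (agreeBelow-≤ N≤ agree))

-- The Ryll-Nardzewski theorem

preimages : {X Y : Set} {v : X → Y} → (∀ y → ∃ λ x → v x ≡ y) → (ys : Vec Y n) →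
            ∃ λ xs → Vec.map v xs ≡ ys
preimages sur []       = [] , refl
preimages sur (y ∷ ys) =
  let (x , eq) = sur y ; (xs , eqs) = preimages sur ys in x ∷ xs , cong₂ _∷_ eq eqs

interpolate : {X : Set} → X → (xs : Vec X n) → ∃ λ (a : ℕ → X) → Vec.map a (Vec.tabulate Fin.toℕ) ≡ xs
interpolate         x₀ []       = (λ _ → x₀) , refl
interpolate {X = X} x₀ (x ∷ xs) =
  let (a , eq) = interpolate x₀ xs in
  x ◂ a , cong (x ∷_) (trans (sym (Vec.tabulate-∘ (x ◂ a) (suc ∘ Fin.toℕ)))
    (trans (Vec.tabulate-∘ a Fin.toℕ) eq))
  where
  _◂_ : X → (ℕ → X) → ℕ → X
  (x ◂ a) zero    = x
  (x ◂ a) (suc k) = a k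

module RyllNardzewski (em : ExcludedMiddle 0ℓ) {L : Signature} (𝔄 : Structure L)
  (T : Theory L) (categorical : ℵ₀-CategoricalTheory T) (model : CountableModel T 𝔄) where

  open Items 𝔄

  private
    A = Carrier 𝔄

    infinite : ℕ ↣ A
    infinite = ↔⇒↣ (↔-sym (proj₁ model))

  module _ {K : Set} (k₀ : K) (Z : K → Pred (ℕ → A) 0ℓ)
    (Z-directed : ∀ k l → ∃ λ m → Z m ⊆ Z k × Z m ⊆ Z l)
    (Z-support : ∃ λ N → ∀ k {a a′} → AgreeBelow N a a′ → Z k a → Z k a′) where

    open GenericType em 𝔄 Z Z-directed Z-support

    genericEnumeration :
      {E : Set} (tasks : ℕ → List E) (tasks-complete : ∀ e → ∃ λ N → e ∈ₗ tasks N)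
      (D : E → Pred (List (Item L)) 0ℓ) (D-mono : ∀ e {Γ Δ} → Γ ⊆ₗ Δ → D e Γ → D e Δ)
      (D-dense : ∀ e {Γ} → Large Γ → ∃ λ Δ → Γ ⊆ₗ Δ × Large Δ × D e Δ) → Large [] →
      ∃ λ (v : ℕ → A) → (∀ x → ∃ λ k → v k ≡ x) ×
        (∀ Γ → All (v ⊨_) Γ → Large Γ) × (∀ e → ∃ λ Γ → All (v ⊨_) Γ × D e Γ)
    genericEnumeration tasks tasks-complete D D-mono D-dense large =
      let (H , decided , H-large , met) = genericType tasks tasks-complete D D-mono D-dense large
          consistent = λ Γ Γ⊆H → let (a , _ , s) = H-large Γ Γ⊆H k₀ in a , s
          𝔐 = HenkinModel.𝔐 em 𝔄 infinite H decided consistent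
          𝔐⊨T = HenkinModel.𝔐-models em 𝔄 infinite H decided consistent T (proj₂ model)
          (v , v-surjective , v⊨) = HenkinModel.realise em 𝔄 infinite H decided consistent
            (proj₂ categorical 𝔐 𝔄 (↔-id _ , 𝔐⊨T) model)
      in v , v-surjective
       , (λ Γ s → H-large Γ (All.map (λ {i} → to (v⊨ i)) s))
       , (λ e → let (Γ , Γ⊆H , d) = met e in Γ , All.map (λ {i} → from (v⊨ i)) Γ⊆H , d)

  private
    -- Otherwise the type of t could be omitted.
    isolated : (t : Vec A n) → ∃ (IsolatedBy em 𝔄 (allFormulas 𝔄) t)
    isolated {n} t = decidable-stable em λ ¬iso →
      let (v , v-surjective , _ , met) = genericEnumeration tt Z Z-directed (0 , λ _ _ _ → tt)
            (λ N → vecs (upTo N) n)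
            (λ ks → let (N , f) = Enumeration.tuples-eventually em L ks in N , f N ℕ.≤-refl)
            Omits (λ ks Γ⊆Δ → Product.map₂ (Product.map₂ Γ⊆Δ)) (dense ¬iso)
            (λ _ → (λ _ → Injection.to infinite 0) , tt , [])
          (ks , map-ks)  = preimages v-surjective t
          (Γ , s , χ , χ-t , χ∈) = met ks
      in All.lookup s χ∈ (subst (Sat 𝔄 χ) (sym map-ks) χ-t)
      where
      Z : ⊤ → Pred (ℕ → A) 0ℓ
      Z _ _ = ⊤

      Z-directed : ∀ k l → ∃ λ m → Z m ⊆ Z k × Z m ⊆ Z l
      Z-directed _ _ = tt , id , id

      open GenericType em 𝔄 Z Z-directed (0 , λ _ _ _ → tt) using (Large)

      Omits : Vec ℕ n → Pred (List (Item L)) 0ℓ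
      Omits ks Γ = ∃ λ χ → Sat 𝔄 χ t × (n , ∼ χ , ks) ∈ₗ Γ

      dense : ¬ ∃ (IsolatedBy em 𝔄 (allFormulas 𝔄) t) →
              ∀ ks {Γ} → Large Γ → ∃ λ Δ → Γ ⊆ₗ Δ × Large Δ × Omits ks Δ
      dense ¬iso ks {Γ} large with em {∃ λ χ → Sat 𝔄 χ t × Large ((n , ∼ χ , ks) ∷ Γ)}
      ... | yes (χ , χ-t , l) = _ , there , l , χ , χ-t , here refl
      ... | no ¬omit = contradiction (θ , tt , θ-t , θ-isolates) ¬iso
        where
        -- If no formula true of `t` can be denied of `ks`, then `Γ` implies all of them about `ks`;
        -- so the formula defining the possible values of `ks` under `Γ` isolates the type of `t`.
        implied : ∀ {a} → All (a ⊨_) Γ → ∀ χ → Sat 𝔄 χ t → Sat 𝔄 χ (Vec.map a ks)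
        implied {a} s χ χ-t = decidable-stable em λ ¬χ →
          ¬omit (χ , χ-t , λ _ → a , tt , ¬χ ∷ s)
        θ = proj₁ (Projection.projection 𝔄 Γ ks)
        Sat-θ = proj₂ (Projection.projection 𝔄 Γ ks)
        -- Otherwise `∼ θ` would itself be true of `t`, and so be implied at a value of `ks` which
        -- satisfies `θ`.
        θ-t : Sat 𝔄 θ t
        θ-t = decidable-stable em λ ¬θ →
          let (a , _ , s) = large tt in implied s (∼ θ) ¬θ (from (Sat-θ _) (a , s , refl))
        θ-isolates : ∀ d → Sat 𝔄 θ d → ∀ χ → ⊤ → Sat 𝔄 χ t → Sat 𝔄 χ d
        θ-isolates d θ-d χ _ χ-t with to (Sat-θ d) θ-d
        ... | a , s , refl = implied s χ χ-t

    sameType⇒conjugate : (t u : Vec A n) → (∀ φ → Sat 𝔄 φ t → Sat 𝔄 φ u) →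
                         Conjugate {𝔐 = 𝔄} t u
    sameType⇒conjugate t u same =
      let (σ , σ∈ , eqs) = extendToAutomorphism em 𝔄 isolated
            (Inverse.from (proj₁ model))
            (λ a → Inverse.to (proj₁ model) a , Inverse.strictlyInverseʳ (proj₁ model) a)
            {Vec.toList (Vec.zip t u)} (preserving-zip t u (λ φ _ → same φ))
      in σ , σ∈ , map-zip t u eqs
      where open PartialMaps em 𝔄 (allFormulas 𝔄)

  -- Otherwise an enumeration of 𝔄 could start with a tuple outside all orbits.
  finiteOrbits : FiniteOrbits 𝔄
  finiteOrbits n = decidable-stable em λ ¬finite →
    let (v , _ , v-large , _) = genericEnumeration [] Z Z-directed Z-support
          {E = ⊥} (λ _ → []) (λ ()) (λ ()) (λ ()) (λ ())
          (λ rs → let (xs , new) = ¬∀⇒∃¬ em λ covers → ¬finite (rs , covers) in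
            let (a , eq) = interpolate (Injection.to infinite 0) xs in
            a , (λ old → new (subst (λ ys → Any (λ r → Conjugate {𝔐 = 𝔄} r ys) rs) eq old)) , [])
        t = Vec.map v variables
        (θ , _ , θ-t , θ-isolates) = isolated t
        -- Largeness of the realised item is tested against the orbit of `t` itself: some tuple
        -- outside that orbit satisfies `θ`, hence has the type of `t`.
        (a , ¬conj , θ-a) = v-large ((n , θ , variables) ∷ []) (θ-t ∷ []) (t ∷ [])
    in ¬conj (here (sameType⇒conjugate t _ λ φ → θ-isolates _ (All.head θ-a) φ tt))
    where
    variables : Vec ℕ n
    variables = Vec.tabulate Fin.toℕ

    Z : List (Vec A n) → Pred (ℕ → A) 0ℓ
    Z rs a = ¬ Any (λ r → Conjugate {𝔐 = 𝔄} r (Vec.map a variables)) rs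

    Z-directed : ∀ rs ss → ∃ λ ts → Z ts ⊆ Z rs × Z ts ⊆ Z ss
    Z-directed rs ss = rs ++ ss , (λ z → z ∘ Any.++⁺ˡ) , (λ z → z ∘ Any.++⁺ʳ rs)

    Z-support : ∃ λ N → ∀ rs {a a′} → AgreeBelow N a a′ → Z rs a → Z rs a′
    Z-support = let (N , supp) = map-support variables in
      N , λ rs agree → subst (λ xs → ¬ Any (λ r → Conjugate {𝔐 = 𝔄} r xs) rs) (supp agree)

module _ (em : ExcludedMiddle 0ℓ) {L : Signature} (𝔄 : Structure L) where

  private
    A = Carrier 𝔄

  ℵ₀-categorical⇒finiteOrbits : ℵ₀-Categorical 𝔄 → FiniteOrbits 𝔄
  ℵ₀-categorical⇒finiteOrbits (inj₂ (T , categorical , model)) =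
    RyllNardzewski.finiteOrbits em 𝔄 T categorical model
  -- A finite structure has finitely many tuples of each length, and each serves as its own
  -- representative.
  ℵ₀-categorical⇒finiteOrbits (inj₁ (N , A↔Fin)) n = vecs elements n , λ xs →
    Any.map (λ { refl → Monoid.ε (Emb 𝔄) , identity∈Aut , Vec.map-id xs })
      (vecs-complete (VecAll.lookup⁻ λ x → element (Vec.lookup xs x)))
    where
    identity∈Aut : Monoid.ε (Emb 𝔄) ∈ Aut 𝔄
    identity∈Aut x = x , id

    elements : List A
    elements = List.map (Inverse.from A↔Fin) (allFin N)

    element : ∀ x → x ∈ₗ elements
    element x = subst (_∈ₗ elements) (Inverse.strictlyInverseʳ A↔Fin x)
      (∈ₗ.∈-map⁺ (Inverse.from A↔Fin) (∈ₗ.∈-allFin (Inverse.to A↔Fin x)))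

  ℵ₀-categorical⇒enumerable : ℵ₀-Categorical 𝔄 → A → ∃ λ (e : ℕ → A) → ∀ a → ∃ λ k → e k ≡ a
  ℵ₀-categorical⇒enumerable (inj₂ (T , _ , (A↔ℕ , _))) _ =
    Inverse.from A↔ℕ , λ a → Inverse.to A↔ℕ a , Inverse.strictlyInverseʳ A↔ℕ a
  ℵ₀-categorical⇒enumerable (inj₁ (N , A↔Fin)) x₀ = e , λ a →
    Fin.toℕ (Inverse.to A↔Fin a) , trans (e-toℕ _) (Inverse.strictlyInverseʳ A↔Fin a)
    where
    e : ℕ → A
    e k with k ℕ.<? N
    ... | yes k<N = Inverse.from A↔Fin (Fin.fromℕ< k<N)
    ... | no _    = x₀

    e-toℕ : ∀ i → e (Fin.toℕ i) ≡ Inverse.from A↔Fin i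
    e-toℕ i with Fin.toℕ i ℕ.<? N
    ... | yes i<N = cong (Inverse.from A↔Fin) (Fin.fromℕ<-toℕ i i<N)
    ... | no i≮N  = contradiction (Fin.toℕ<n i) i≮N

-- Sets of tuples closed under self-embeddings

concat-injective : {X : Set} (xss yss : Vec (Vec X n) m) → Vec.concat xss ≡ Vec.concat yss → xss ≡ yss
concat-injective []         []         eq = refl
concat-injective (xs ∷ xss) (ys ∷ yss) eq = let (p , q) = Vec.++-injective xs ys eq in
  cong₂ _∷_ p (concat-injective xss yss q)

module Oligomorphic (em : ExcludedMiddle 0ℓ) {L : Signature} (𝔄 : Structure L)
  (orbits : FiniteOrbits 𝔄) (x₀ : Carrier 𝔄)
  (e : ℕ → Carrier 𝔄) (e-surjective : ∀ a → ∃ λ k → e k ≡ a) where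

  private
    A = Carrier 𝔄

    -- Each representative either fails an existential formula true of `c`, which is then conjoined
    -- to `ψ`, or satisfies all of them. Only finitely many conjuncts arise.
    separate : (c : Vec A n) → ∀ rs → ∃ λ ψ → Existential ψ × Sat 𝔄 ψ c ×
               All (λ r → Sat 𝔄 ψ r → ∀ φ → Existential φ → Sat 𝔄 φ c → Sat 𝔄 φ r) rs
    -- A true formula; its variable is bound because `n` may be 0.
    separate c []       = ex (var zero ≐ var zero) , ex (qf (_ ≐ _)) , (x₀ , refl) , []
    separate c (r ∷ rs) with separate c rs | em {∃ λ φ → Existential φ × Sat 𝔄 φ c × ¬ Sat 𝔄 φ r}
    ... | ψ , ψ-ex , ψ-c , seps | yes (φ , φ-ex , φ-c , ¬φ-r) =
      let (χ , χ-ex , sat) = existential-∧ 𝔄 φ-ex ψ-ex in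
      χ , χ-ex , from (sat c) (φ-c , ψ-c) ,
      (λ χ-r → contradiction (proj₁ (to (sat r) χ-r)) ¬φ-r)
      ∷ All.map (λ sep χ-r → sep (proj₂ (to (sat _) χ-r))) seps
    ... | ψ , ψ-ex , ψ-c , seps | no ¬φ =
      ψ , ψ-ex , ψ-c ,
      (λ _ φ φ-ex φ-c → decidable-stable em λ ¬φ-r → ¬φ (φ , φ-ex , φ-c , ¬φ-r)) ∷ seps

    -- Automorphisms preserve all formulas, so a formula that works for the representatives works
    -- for every tuple.
    isolated : (c : Vec A n) → ∃ (IsolatedBy em 𝔄 (existentialFormulas 𝔄) c)
    isolated {n} c =
      let (reps , covers) = orbits n ; (ψ , ψ-ex , ψ-c , seps) = separate c reps in
      ψ , ψ-ex , ψ-c , λ d ψ-d φ φ-ex φ-c →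
        let (sep , (γ , γ∈ , γr≡d)) = All.lookupAny seps (covers d)
            transfer = λ χ → Sat-iso γ γ∈ χ (Any.lookup (covers d)) ⟨⇔⟩ ≡⇒⇔ (Sat 𝔄 χ) γr≡d
        in to (transfer φ) (sep (from (transfer ψ) ψ-d) φ φ-ex φ-c)

    embed : (c d : Vec A n) → Sat 𝔄 (proj₁ (isolated c)) d →
            ∃ λ (σ : Embedding 𝔄 𝔄) → Vec.map (Emb.map σ) c ≡ d
    embed c d ψ-d =
      let (ψ , _ , _ , isolates) = isolated c
          (σ , eqs) = extendToEmbedding isolated e e-surjective {Vec.toList (Vec.zip c d)}
                        (preserving-zip c d (isolates d ψ-d))
      in σ , map-zip c d eqs
      where open PartialMaps em 𝔄 (existentialFormulas 𝔄)

    unionOver : (S : Pred (Vec A n) 0ℓ) → ∀ rs → ∃ λ φ → Existential φ ×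
                (∀ d → Sat 𝔄 φ d ⇔ Any (λ r → S r × Sat 𝔄 (proj₁ (isolated r)) d) rs)
    unionOver S [] = ex (∼ (var zero ≐ var zero)) , ex (qf (∼ (_ ≐ _))) ,
      λ d → mk⇔ (λ (a , a≢a) → contradiction refl a≢a) (λ ())
    unionOver S (r ∷ rs) with unionOver S rs | em {S r}
    ... | φ , φ-ex , sat | no ¬r = φ , φ-ex , λ d → sat d ⟨⇔⟩
      mk⇔ there (λ { (here (r∈ , _)) → contradiction r∈ ¬r ; (there p) → p })
    ... | φ , φ-ex , sat | yes r∈ =
      let (ψ , ψ-ex , _)    = isolated r
          (χ , χ-ex , sat′) = existential-∨ 𝔄 x₀ ψ-ex φ-ex
      in χ , χ-ex , λ d → sat′ d ⟨⇔⟩ (⇔-id _ ⊎-⇔ sat d) ⟨⇔⟩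
        mk⇔ Sum.[ (λ s → here (r∈ , s)) , there ]′
            (λ { (here (_ , s)) → inj₁ s ; (there p) → inj₂ p })

  -- A closed set is the union of the sets defined by the isolating formulas of the representatives
  -- in it: `embed` moves a representative to any tuple satisfying its formula, and an inverse
  -- automorphism brings a member back to its representative.
  closed⇒existential : (S : Pred (Vec A n) 0ℓ) →
                       (∀ (σ : Embedding 𝔄 𝔄) {xs} → S xs → S (Vec.map (Emb.map σ) xs)) →
                       ∃ λ φ → Existential φ × (∀ xs → Sat 𝔄 φ xs ⇔ S xs)
  closed⇒existential {n} S closed =
    let (reps , covers) = orbits n ; (φ , φ-ex , sat) = unionOver S reps in
    φ , φ-ex , λ xs → sat xs ⟨⇔⟩ mk⇔
      sound
      (λ xs∈ → Any.map (λ {r} conj@(γ , _ , γr≡xs) →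
          let (γ⁻¹ , _ , eq) = Conjugate-sym {𝔐 = 𝔄} conj
              (ψ , ψ-ex , ψ-r , _) = isolated r
          in subst S eq (closed γ⁻¹ xs∈) ,
             subst (Sat 𝔄 ψ) γr≡xs (Sat-existential γ ψ-ex ψ-r))
        (covers xs))
    where
    sound : ∀ {xs rs} → Any (λ r → S r × Sat 𝔄 (proj₁ (isolated r)) xs) rs → S xs
    sound (here (r∈ , ψ-xs)) = let (σ , eq) = embed _ _ ψ-xs in subst S eq (closed σ r∈)
    sound (there some)       = sound some

  closed⇒existentiallyDefinable : ∀ {k} (S : Pred (Vec (Vec A n) k) 0ℓ) →
    (∀ (σ : Embedding 𝔄 𝔄) {ās} → S ās → S (Vec.map (Vec.map (Emb.map σ)) ās)) →
    ExistentiallyDefinable 𝔄 S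
  closed⇒existentiallyDefinable S closed =
    let (φ , φ-ex , sat) = closed⇒existential (λ v → ∃ λ ās → Vec.concat ās ≡ v × S ās)
          (λ { σ (ās , refl , s) → _ , sym (Vec.map-concat (Emb.map σ) ās) , closed σ s })
    in φ , φ-ex , λ ās → sat (Vec.concat ās) ⟨⇔⟩ mk⇔
      (λ (b̄s , eq , s) → subst S (concat-injective b̄s ās eq) s)
      (λ s → ās , refl , s)

-- From interpretations to continuous homomorphisms

module FromInterpretation (em : ExcludedMiddle 0ℓ) {L L′ : Signature}
  (𝔄 : Structure L) (𝔅 : Structure L′) (I : Interpretation 𝔅 𝔄)
  (existential : Interpretation.IsExistential I) where

  open Interpretation I

  private
    A   = Carrier 𝔄
    B   = Carrier 𝔅
    Dom = [ ā ∈ Vec A dim ∣ dom ā ]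

    i-cong : ∀ u u′ → value u ≡ value u′ → i u ≡ i u′
    i-cong _ _ refl = refl

    preimage-closed : ∀ s (σ : Embedding 𝔄 𝔄) ās → preimage (⟦ s ⟧ 𝔅) ās →
                      preimage (⟦ s ⟧ 𝔅) (Vec.map (Vec.map (Emb.map σ)) ās)
    preimage-closed s σ ās p =
      let (φ , φ-ex , defines) = existential s in
      to (defines _) (subst (Sat 𝔄 φ) (Vec.map-concat (Emb.map σ) ās)
        (Sat-existential σ φ-ex (from (defines ās) p)))

    move : (σ : Embedding 𝔄 𝔄) (u : Dom) → ∃ λ u′ → value u′ ≡ Vec.map (Emb.map σ) (value u)
    move σ u with preimage-closed universe σ (value u ∷ []) (u ∷ [] , refl , _)
    ... | u′ ∷ [] , eq , _ = u′ , Vec.∷-injectiveˡ eq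

    -- The preimage of the diagonal is the kernel of `i`; its existential definability is what makes
    -- the action on `𝔅` well defined.
    move-cong : ∀ σ {u u′} → i u ≡ i u′ → i (proj₁ (move σ u)) ≡ i (proj₁ (move σ u′))
    move-cong σ {u} {u′} eq
      with preimage-closed diagonal σ (value u ∷ value u′ ∷ []) (u ∷ u′ ∷ [] , refl , eq)
    ... | v ∷ v′ ∷ [] , eqs , iv≡iv′ =
      trans (i-cong _ _ (trans (proj₂ (move σ u)) (sym (Vec.∷-injectiveˡ eqs))))
        (trans iv≡iv′ (i-cong _ _ (trans (Vec.∷-injectiveˡ (Vec.∷-injectiveʳ eqs))
          (sym (proj₂ (move σ u′))))))

    rep : B → Dom
    rep b = proj₁ (surjective b)

    i-rep : ∀ b → i (rep b) ≡ b
    i-rep b = proj₂ (surjective b) refl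

    act : Embedding 𝔄 𝔄 → B → B
    act σ b = i (proj₁ (move σ (rep b)))

    act-i : ∀ σ u u′ → value u′ ≡ Vec.map (Emb.map σ) (value u) → act σ (i u) ≡ i u′
    act-i σ u u′ eq = trans (move-cong σ (i-rep (i u)))
      (i-cong _ _ (trans (proj₂ (move σ u)) (sym eq)))

    act-is : ∀ σ {k} (bs : Vec B k) (us : Vec Dom k) →
             Vec.map value us ≡ Vec.map (Vec.map (Emb.map σ)) (Vec.map (value ∘ rep) bs) →
             Vec.map i us ≡ Vec.map (act σ) bs
    act-is σ []       []       _  = refl
    act-is σ (b ∷ bs) (u ∷ us) eq = cong₂ _∷_
      (trans (sym (act-i σ (rep b) u (Vec.∷-injectiveˡ eq))) (cong (act σ) (i-rep b)))
      (act-is σ bs us (Vec.∷-injectiveʳ eq))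

    moveBasic : ∀ s σ bs → bs ∈ ⟦ s ⟧ 𝔅 → Vec.map (act σ) bs ∈ ⟦ s ⟧ 𝔅
    moveBasic s σ bs bs∈ =
      let (us , eq , us∈) = preimage-closed s σ (Vec.map (value ∘ rep) bs)
            ( Vec.map rep bs
            , sym (Vec.map-∘ value rep bs)
            , subst (⟦ s ⟧ 𝔅) (sym (trans (sym (Vec.map-∘ i rep bs))
                (trans (Vec.map-cong i-rep bs) (Vec.map-id bs)))) bs∈ )
      in subst (⟦ s ⟧ 𝔅) (act-is σ bs us eq) us∈

    hom : Embedding 𝔄 𝔄 → Homomorphism 𝔅 𝔅
    hom σ = record
      { map       = act σ
      ; preserves = λ R {xs} → moveBasic (rel R) σ xs
      ; fixes     = λ c → moveBasic (const c) σ (_ ∷ []) refl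
      }

    -- This gives continuity: the action on `bs` is read off from the values of the embedding on the
    -- chosen preimages.
    act-local : ∀ σ τ {k} (bs : Vec B k) →
                let ā = Vec.concat (Vec.map (value ∘ rep) bs) in
                Vec.map (Emb.map σ) ā ≡ Vec.map (Emb.map τ) ā → Vec.map (act σ) bs ≡ Vec.map (act τ) bs
    act-local σ τ []       _  = refl
    act-local σ τ (b ∷ bs) eq =
      let (p , q) = Vec.++-injective (Vec.map (Emb.map σ) (value (rep b))) _
            (trans (sym (Vec.map-++ (Emb.map σ) (value (rep b)) _))
              (trans eq (Vec.map-++ (Emb.map τ) (value (rep b)) _)))
      in cong₂ _∷_ (i-cong _ _ (trans (proj₂ (move σ (rep b))) (trans p (sym (proj₂ (move τ (rep b)))))))
           (act-local σ τ bs q)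

  continuousHomomorphism : ContinuousMonoidHomomorphism 𝔄 𝔅
  continuousHomomorphism = record
    { fun                  = hom
    ; isMonoidHomomorphism = record
      { isMagmaHomomorphism = record
        { isRelHomomorphism = record
          { cong = λ {σ} {τ} σ≈τ b → i-cong _ _ (trans (proj₂ (move σ (rep b)))
              (trans (Vec.map-cong σ≈τ _) (sym (proj₂ (move τ (rep b)))))) }
        ; homo = λ σ τ b → sym (act-i τ _ _ (trans (proj₂ (move (σ ⨾ τ) (rep b)))
            (trans (Vec.map-∘ (Emb.map τ) (Emb.map σ) _)
              (cong (Vec.map (Emb.map τ)) (sym (proj₂ (move σ (rep b))))))))
        }
      ; ε-homo = λ b → trans
          (i-cong _ _ (trans (proj₂ (move (Monoid.ε (Emb 𝔄)) (rep b))) (Vec.map-id _))) (i-rep b)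
      }
    ; continuous           = λ open-O {σ} σ∈ →
        let (k , bs , _ , eq , basic⊆O) = open-O σ∈ in
        k * dim , Vec.concat (Vec.map (value ∘ rep) bs) , _ , refl ,
        λ {τ} τ∈ → basic⊆O (trans (act-local τ σ bs τ∈) eq)
    }

  open ContinuousMonoidHomomorphism continuousHomomorphism using (image)

  finitelyManyOrbits : FiniteOrbits 𝔄 → CoveredByFinitelyManyOrbits (image (Aut 𝔄))
  finitelyManyOrbits orbits =
    let (reps , covers) = orbits dim in
    values reps , λ x → covered x reps (covers (value (rep x)))
    where
    values : List (Vec A dim) → List B
    values []       = []
    values (r ∷ rs) with em {∃ λ (u : Dom) → value u ≡ r}
    ... | yes (u , _) = i u ∷ values rs
    ... | no _        = values rs

    covered : ∀ x rs → Any (λ r → Conjugate {𝔐 = 𝔄} r (value (rep x))) rs →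
              Any (λ b → Orbit {𝔅 = 𝔅} (image (Aut 𝔄)) b x) (values rs)
    covered x (r ∷ rs) p with em {∃ λ (u : Dom) → value u ≡ r} | p
    ... | yes (u , refl) | here (γ , γ∈ , eq) = here (hom γ , (γ , γ∈ , λ _ → refl) ,
      trans (act-i γ u (rep x) (sym eq)) (i-rep x))
    ... | yes _          | there q = there (covered x rs q)
    ... | no _           | there q = covered x rs q
    -- The domain is closed under `γ⁻¹`, so the representative of an orbit meeting it lies in it.
    ... | no ¬u          | here conj = let (γ⁻¹ , _ , eq) = Conjugate-sym {𝔐 = 𝔄} conj in
      contradiction (proj₁ (move γ⁻¹ (rep x)) , trans (proj₂ (move γ⁻¹ (rep x))) eq) ¬u

-- From continuous homomorphisms to interpretations

module FromHomomorphism (em : ExcludedMiddle 0ℓ) {L L′ : Signature}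
  (𝔄 : Structure L) (𝔅 : Structure L′) (f : ContinuousMonoidHomomorphism 𝔄 𝔅)
  (orbits : FiniteOrbits 𝔄)
  (e : ℕ → Carrier 𝔄) (e-surjective : ∀ a → ∃ λ k → e k ≡ a) where

  open ContinuousMonoidHomomorphism f
  open MonoidMorphisms (Monoid.rawMonoid (Emb 𝔄)) (Monoid.rawMonoid (End 𝔅))
    using (module IsMonoidHomomorphism)
  open IsMonoidHomomorphism isMonoidHomomorphism using (⟦⟧-cong; homo; ε-homo)

  private
    A = Carrier 𝔄
    B = Carrier 𝔅

    act : Embedding 𝔄 𝔄 → B → B
    act σ = Hom.map (fun σ)

    -- A monoid homomorphism sends the inverse of `γ` to a map undoing the action of `γ`.
    act-injective : ∀ γ → γ ∈ Aut 𝔄 → ∀ {b b′} → act γ b ≡ act γ b′ → b ≡ b′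
    act-injective γ γ∈ {b} {b′} eq = trans (sym (cancel b))
      (trans (cong (act (inverse γ γ∈)) eq) (cancel b′))
      where
      cancel : ∀ b → act (inverse γ γ∈) (act γ b) ≡ b
      cancel b = trans (sym (homo γ (inverse γ γ∈) b))
        (trans (⟦⟧-cong {γ ⨾ inverse γ γ∈} {Monoid.ε (Emb 𝔄)} (inverseʳ γ γ∈) b) (ε-homo b))

    locallyConstant : ∀ b σ → ∃ λ n → ∃ λ (ā : Vec A n) →
                      ∀ τ → Vec.map (Emb.map τ) ā ≡ Vec.map (Emb.map σ) ā → act τ b ≡ act σ b
    locallyConstant b σ =
      let (n , ā , b̄ , σ∈ , basic⊆) = continuous {λ g → Hom.map g b ≡ act σ b}
            (λ eq → 1 , b ∷ [] , act σ b ∷ [] , cong (_∷ []) eq , Vec.∷-injectiveˡ) {σ} refl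
      in n , ā , λ τ eq → basic⊆ {τ} (trans eq σ∈)

    AgreeTo : ℕ → (A → A) → (A → A) → Set
    AgreeTo N g h = ∀ {k} → k < N → g (e k) ≡ h (e k)

    agreeTo-map : (xs : Vec A n) → ∃ λ N → ∀ {g h} → AgreeTo N g h → Vec.map g xs ≡ Vec.map h xs
    agreeTo-map xs with preimages e-surjective xs
    ... | ks , refl = let (N , supp) = Items.map-support 𝔄 ks in
      N , λ {g} {h} agree → trans (sym (Vec.map-∘ g e ks)) (trans (supp agree) (Vec.map-∘ h e ks))

    -- The pigeonhole principle. If `x` fails at `N₀`, it fails from there on, and the remaining
    -- elements must serve the indices `N ⊔ N₀`.
    infinitelyOften : {X : Set} (Q : ℕ → X → Set) → (∀ {M N x} → M ≤ N → Q N x → Q M x) →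
                      ∀ xs → (∀ N → Any (Q N) xs) → ∃ λ x → ∀ N → Q N x
    infinitelyOften Q anti []       some with () ← some 0
    infinitelyOften Q anti (x ∷ xs) some with em {∀ N → Q N x}
    ... | yes q = x , q
    ... | no ¬q = let (N₀ , ¬qN₀) = ¬∀⇒∃¬ em ¬q in
      infinitelyOften Q anti xs λ N → tailAny N₀ ¬qN₀ N (some (N ⊔ N₀))
      where
      tailAny : ∀ N₀ → ¬ Q N₀ x → ∀ N → Any (Q (N ⊔ N₀)) (x ∷ xs) → Any (Q N) xs
      tailAny N₀ ¬q N (here q)  = contradiction (anti (ℕ.m≤n⊔m N N₀) q) ¬q
      tailAny N₀ ¬q N (there p) = Any.map (anti (ℕ.m≤m⊔n N N₀)) p

  -- If no N worked, then, up to automorphisms, the pairs (σ , τ) violating the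
  -- claim would accumulate at a pair (ρ , ρ), where the action on b is locally
  -- constant.

  private
    module _ (b : B) where

      Splits : ℕ → Embedding 𝔄 𝔄 → Embedding 𝔄 𝔄 → Set
      Splits N σ τ = AgreeTo N (Emb.map σ) (Emb.map τ) × act σ b ≢ act τ b

      Accumulates : Pred (List (A × A)) 0ℓ
      Accumulates zs = ∀ N → ∃₂ λ σ τ → Splits N σ τ × All (λ (x , y) → Emb.map σ x ≡ y) zs

      agreeOn : ∀ {g h : A → A} (zs : List (A × A)) →
                Vec.map g (Vec.map proj₁ (Vec.fromList zs)) ≡ Vec.map h (Vec.map proj₁ (Vec.fromList zs)) →
                All (λ (x , _) → g x ≡ h x) zs
      agreeOn []       _  = []
      agreeOn (z ∷ zs) eq = Vec.∷-injectiveˡ eq ∷ agreeOn zs (Vec.∷-injectiveʳ eq)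

      -- The images of the finite domain fall into finitely many orbits, so one orbit recurs for all
      -- `N`. Automorphisms `δ` bring these images to the one under a single `σ₀`, which makes `a′`
      -- independent of `N`. Composing with `δ` keeps the agreement, and keeps the disagreement at
      -- `b` because `δ` acts injectively.
      extend : ∀ a {zs} → Accumulates zs → ∃ λ a′ → Accumulates ((a , a′) ∷ zs)
      extend a {zs} acc =
        let (reps , covers) = orbits _
            (r , q) = infinitelyOften Q anti reps λ N → let (σ , τ , split , eqs) = acc N in
              Any.map (λ conj → σ , τ , split , eqs , conj) (covers (image-xs σ))
            (σ₀ , _ , _ , eqs₀ , conj₀) = q 0
        in Emb.map σ₀ a , λ N →
          let (σ , τ , (agree , differ) , _ , conj) = q N
              (δ , δ∈ , eq) = Conjugate-trans {𝔐 = 𝔄} (Conjugate-sym {𝔐 = 𝔄} conj) conj₀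
              onXs = agreeOn ((a , a) ∷ zs) (trans (Vec.map-∘ (Emb.map δ) (Emb.map σ) xs) eq)
          in σ ⨾ δ , τ ⨾ δ
           , ( (λ k<N → cong (Emb.map δ) (agree k<N))
             , (λ same → differ (act-injective δ δ∈ (trans (sym (homo σ δ b)) (trans same (homo τ δ b))))))
           , All.head onXs ∷ All.zipWith (λ (p , q) → trans p q) (All.tail onXs , eqs₀)
        where
        xs = a ∷ Vec.map proj₁ (Vec.fromList zs)

        image-xs : Embedding 𝔄 𝔄 → Vec A _
        image-xs σ = Vec.map (Emb.map σ) xs

        Q : ℕ → Vec A _ → Set
        Q N r = ∃₂ λ σ τ → Splits N σ τ × All (λ (x , y) → Emb.map σ x ≡ y) zs
                           × Conjugate {𝔐 = 𝔄} r (image-xs σ)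

        anti : ∀ {M N r} → M ≤ N → Q N r → Q M r
        anti M≤N (σ , τ , (agree , differ) , rest) =
          σ , τ , ((λ k<M → agree (ℕ.<-≤-trans k<M M≤N)) , differ) , rest

      graph : ∀ {g : A → A} (ws : Vec (A × A) n) → All (λ (x , y) → g x ≡ y) (Vec.toList ws) →
              Vec.map g (Vec.map proj₁ ws) ≡ Vec.map proj₂ ws
      graph []       []         = refl
      graph (w ∷ ws) (eq ∷ eqs) = cong₂ _∷_ eq (graph ws eqs)

      accumulation : Accumulates [] →
                     ∃ λ (ρ : Embedding 𝔄 𝔄) → ∀ {n} (xs : Vec A n) N →
                     ∃₂ λ σ τ → Splits N σ τ × Vec.map (Emb.map σ) xs ≡ Vec.map (Emb.map ρ) xs
      accumulation acc =
        let (G , _ , met , G-acc) = generic Accumulates (λ a zs → ∃ λ a′ → (a , a′) ∈ₗ zs)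
              (λ a zs⊆ws (a′ , z∈) → a′ , zs⊆ws z∈)
              (λ k → e k ∷ []) (λ a → let (k , eq) = e-surjective a in k , here (sym eq))
              (λ a acc → let (a′ , acc′) = extend a acc in _ , there , acc′ , a′ , here refl)
              (λ zs⊆ws acc N → let (σ , τ , split , eqs) = acc N in
                σ , τ , split , All.tabulate (λ z∈ → All.lookup eqs (zs⊆ws z∈)))
              acc
            (ρ , ρ-graph) = graphEmbedding em 𝔄 {G = G}
              (λ a → let (ws , ws⊆G , a′ , z∈) = met a in a′ , All.lookup ws⊆G z∈)
              -- A finite piece of `G` is part of an embedding `σ`, which preserves quantifier-free
              -- formulas.
              (λ φ p ws ws⊆G s →
                let (σ , _ , _ , eqs) = G-acc (Vec.toList ws) (VecAll.toList⁺ ws⊆G) 0 in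
                subst (Sat 𝔄 φ) (graph ws eqs) (to (Sat-qf σ p (Vec.map proj₁ ws)) s))
            G-ρ = λ a → let (ws , ws⊆G , a′ , z∈) = met a in
              subst (λ y → G (a , y)) (sym (ρ-graph (All.lookup ws⊆G z∈))) (All.lookup ws⊆G z∈)
        in ρ , λ xs N →
          let (σ , τ , split , eqs) = G-acc (Vec.toList (Vec.zip xs (Vec.map (Emb.map ρ) xs)))
                (zip⊆ G-ρ xs) N
          in σ , τ , split , map-zip xs _ eqs
        where
        zip⊆ : ∀ {G : Pred (A × A) 0ℓ} {g : A → A} → (∀ a → G (a , g a)) → (xs : Vec A n) →
               All G (Vec.toList (Vec.zip xs (Vec.map g xs)))
        zip⊆ G-g []       = []
        zip⊆ G-g (x ∷ xs) = G-g x ∷ zip⊆ G-g xs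

  DeterminedBy : ℕ → B → Set
  DeterminedBy N b = ∀ σ τ → AgreeTo N (Emb.map σ) (Emb.map τ) → act σ b ≡ act τ b

  determinedBy-≤ : ∀ {b M N} → M ≤ N → DeterminedBy M b → DeterminedBy N b
  determinedBy-≤ M≤N d σ τ agree = d σ τ λ k<M → agree (ℕ.<-≤-trans k<M M≤N)

  uniformlyContinuous : ∀ b → ∃ λ N → DeterminedBy N b
  uniformlyContinuous b = decidable-stable em λ ¬uniform →
    let (ρ , near) = accumulation b λ N → decidable-stable em λ ¬split →
          ¬uniform (N , λ σ τ agree → decidable-stable em λ differ →
            ¬split (σ , τ , (agree , differ) , []))
        (n , ā , local) = locallyConstant b ρ
        (N , agree-ā)   = agreeTo-map ā
        (σ , τ , (agree , differ) , σ≈ρ) = near ā N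
    -- `N` bounds the positions under `e` of the entries of `ā`, so `τ` agrees on `ā` with `σ` and
    -- thereby with `ρ`.
    in differ (trans (local σ σ≈ρ) (sym (local τ (trans (sym (agree-ā agree)) σ≈ρ))))

  uniformlyContinuousOn : ∀ bs → ∃ λ N → All (DeterminedBy N) bs
  uniformlyContinuousOn []       = 0 , []
  uniformlyContinuousOn (b ∷ bs) =
    let (M , d) = uniformlyContinuous b ; (N , ds) = uniformlyContinuousOn bs in
    M ⊔ N , determinedBy-≤ {b} (ℕ.m≤m⊔n M N) d ∷ All.map (λ {c} → determinedBy-≤ {c} (ℕ.m≤n⊔m M N)) ds

  Basic-closed : ∀ s (g : Homomorphism 𝔅 𝔅) bs → bs ∈ ⟦ s ⟧ 𝔅 → Vec.map (Hom.map g) bs ∈ ⟦ s ⟧ 𝔅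
  Basic-closed universe  g bs           _  = _
  Basic-closed diagonal  g (b ∷ c ∷ []) eq = cong (Hom.map g) eq
  Basic-closed (rel R)   g bs           r  = Hom.preserves g R r
  Basic-closed (const c) g (b ∷ [])     eq = trans (cong (Hom.map g) eq) (Hom.fixes g c)

  -- The interpretation obtained by coding representatives

  module _ (x y : A) (x≢y : x ≢ y) (bs : List B)
    (covers : ∀ b → Any (λ c → Orbit {𝔅 = 𝔅} (image U) c b) bs) where

    private
      N : ℕ
      N = proj₁ (uniformlyContinuousOn bs)

      Index = Fin (List.length bs)

      codeAt : Index → Index → A
      codeAt j i with j Fin.≟ i
      ... | yes _ = y
      ... | no _  = x

      codeAt-≡ : ∀ j → codeAt j j ≡ y
      codeAt-≡ j with j Fin.≟ j
      ... | yes _  = refl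
      ... | no j≢j = contradiction refl j≢j

      codeAt-≢ : ∀ {j i} → j ≢ i → codeAt j i ≡ x
      codeAt-≢ {j} {i} j≢i with j Fin.≟ i
      ... | yes j≡i = contradiction j≡i j≢i
      ... | no _    = refl

      -- The equality pattern of the code of j, which embeddings preserve, determines j.
      code : Index → Vec A (suc (List.length bs))
      code j = x ∷ Vec.tabulate (codeAt j)

      code-injective : ∀ (σ τ : Embedding 𝔄 𝔄) {j l} →
                       Vec.map (Emb.map σ) (code j) ≡ Vec.map (Emb.map τ) (code l) → j ≡ l
      code-injective σ τ {j} {l} eq = decidable-stable (j Fin.≟ l) λ j≢l →
        -- At position `j` the two codes carry `y` and `x`, so `σ` takes `y` to the value of `τ` at
        -- `x`, which by the leading entry is the value of `σ` at `x`.
        x≢y (Emb.injective σ (trans (Vec.∷-injectiveˡ eq) (sym (trans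
          (cong (Emb.map σ) (sym (codeAt-≡ j)))
          (trans (at j) (cong (Emb.map τ) (codeAt-≢ (j≢l ∘ sym))))))))
        where
        at : ∀ i → Emb.map σ (codeAt j i) ≡ Emb.map τ (codeAt l i)
        at i = trans (sym (lookup-code (Emb.map σ) j))
          (trans (cong (λ v → Vec.lookup v i) (Vec.∷-injectiveʳ eq)) (lookup-code (Emb.map τ) l))
          where
          lookup-code : ∀ (g : A → A) j → Vec.lookup (Vec.map g (Vec.tabulate (codeAt j))) i ≡ g (codeAt j i)
          lookup-code g j = trans (Vec.lookup-map i g (Vec.tabulate (codeAt j)))
            (cong g (Vec.lookup∘tabulate (codeAt j) i))

      initial : Vec A N
      initial = Vec.tabulate (e ∘ Fin.toℕ)

      initial-agree : ∀ {g h} → Vec.map g initial ≡ Vec.map h initial → AgreeTo N g h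
      initial-agree {g} {h} eq {k} k<N =
        trans (sym (lookup-initial g))
          (trans (cong (λ v → Vec.lookup v (Fin.fromℕ< k<N)) eq) (lookup-initial h))
        where
        lookup-initial : ∀ g → Vec.lookup (Vec.map g initial) (Fin.fromℕ< k<N) ≡ g (e k)
        lookup-initial g = trans (Vec.lookup-map (Fin.fromℕ< k<N) g initial)
          (cong g (trans (Vec.lookup∘tabulate (e ∘ Fin.toℕ) _) (cong e (Fin.toℕ-fromℕ< k<N))))

      dim = suc (List.length bs) + N

      tuple : Index → Vec A dim
      tuple j = code j Vec.++ initial

      -- Equal codes give the same representative, and equality on `initial` is what `N` was chosen
      -- for; this makes `i` well defined.
      tuple-determines : ∀ σ τ {j l} → Vec.map (Emb.map σ) (tuple j) ≡ Vec.map (Emb.map τ) (tuple l) →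
                         act σ (List.lookup bs j) ≡ act τ (List.lookup bs l)
      tuple-determines σ τ {j} {l} eq =
        let (p , q) = Vec.++-injective (Vec.map (Emb.map σ) (code j)) (Vec.map (Emb.map τ) (code l))
              (trans (sym (Vec.map-++ (Emb.map σ) (code j) initial))
                (trans eq (Vec.map-++ (Emb.map τ) (code l) initial)))
        in determined p (initial-agree q)
        where
        determined : Vec.map (Emb.map σ) (code j) ≡ Vec.map (Emb.map τ) (code l) →
                     AgreeTo N (Emb.map σ) (Emb.map τ) →
                     act σ (List.lookup bs j) ≡ act τ (List.lookup bs l)
        determined p agree with refl ← code-injective σ τ {j} {l} p =
          All.lookup (proj₂ (uniformlyContinuousOn bs)) (∈ₗ.∈-lookup j) σ τ agree

      dom : Pred (Vec A dim) 0ℓ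
      dom ā = ∃₂ λ (j : Index) (σ : Embedding 𝔄 𝔄) → Vec.map (Emb.map σ) (tuple j) ≡ ā

      Dom = [ ā ∈ Vec A dim ∣ dom ā ]

      -- Membership is irrelevant in `Dom`, so excluded middle has to recover some `j` and `σ`;
      -- which ones does not matter by `tuple-determines`.
      dom-value : (u : Dom) → dom (value u)
      dom-value (_ , [ p ]) = recompute em p

      i : Dom → B
      i u = let (j , σ , _) = dom-value u in act σ (List.lookup bs j)

      i-≡ : ∀ u j σ → Vec.map (Emb.map σ) (tuple j) ≡ value u → i u ≡ act σ (List.lookup bs j)
      i-≡ u j σ eq = let (_ , τ , eq′) = dom-value u in tuple-determines τ σ (trans eq′ (sym eq))

      move : Embedding 𝔄 𝔄 → Dom → Dom
      move γ (ā , p) = Vec.map (Emb.map γ) ā ,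
        Irrelevant.map (λ (j , σ , eq) → j , σ ⨾ γ ,
          trans (Vec.map-∘ (Emb.map γ) (Emb.map σ) (tuple j)) (cong (Vec.map (Emb.map γ)) eq)) p

      -- Equivariance of `i`. As `fun γ` is an endomorphism, it makes the preimages of the basic
      -- sets closed under `γ`, which their existential definability rests on.
      i-move : ∀ γ u → i (move γ u) ≡ act γ (i u)
      i-move γ u = let (j , σ , eq) = dom-value u in
        trans (i-≡ (move γ u) j (σ ⨾ γ)
            (trans (Vec.map-∘ (Emb.map γ) (Emb.map σ) (tuple j)) (cong (Vec.map (Emb.map γ)) eq)))
          (homo σ γ _)

      surjective : ∀ b → ∃ λ u → ∀ {v} → v ≡ u → i v ≡ b
      surjective b =
        let (g , (σ , _ , σ≗g) , eq) = Any.lookup-index (covers b)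
            j = Any.index (covers b)
            u = Vec.map (Emb.map σ) (tuple j) , [ j , σ , refl ]
        in u , λ { refl → trans (i-≡ u j σ refl) (trans (σ≗g _) eq) }

      preimage : ∀ {k} → Pred (Vec B k) 0ℓ → Pred (Vec (Vec A dim) k) 0ℓ
      preimage S ās = ∃ λ us → Vec.map value us ≡ ās × Vec.map i us ∈ S

      preimage-closed : ∀ s (γ : Embedding 𝔄 𝔄) {ās} → preimage (⟦ s ⟧ 𝔅) ās →
                        preimage (⟦ s ⟧ 𝔅) (Vec.map (Vec.map (Emb.map γ)) ās)
      preimage-closed s γ (us , refl , us∈) = Vec.map (move γ) us
        , trans (sym (Vec.map-∘ value (move γ) us)) (Vec.map-∘ (Vec.map (Emb.map γ)) value us)
        , subst (⟦ s ⟧ 𝔅)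
            (trans (sym (Vec.map-∘ (act γ) i us)) (trans (Vec.map-cong (λ u → sym (i-move γ u)) us)
              (Vec.map-∘ i (move γ) us)))
            (Basic-closed s (fun γ) _ us∈)

      definable : ∀ s → ExistentiallyDefinable 𝔄 (preimage (⟦ s ⟧ 𝔅))
      definable s = Oligomorphic.closed⇒existentiallyDefinable em 𝔄 orbits x e e-surjective
        (preimage (⟦ s ⟧ 𝔅)) (preimage-closed s)

    interpretable : 𝔅 ExistentiallyInterpretableIn 𝔄
    interpretable = record
      { dim        = dim
      ; dom        = dom
      ; i          = i
      ; surjective = surjective
      ; definable  = λ s → let (φ , _ , defines) = definable s in φ , defines
      } , definable

theorem7 : ExcludedMiddle 0ℓ →
    {L L′ : Signature} (𝔄 : Structure L) (𝔅 : Structure L′) →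
    ℵ₀-Categorical 𝔄 → AtLeastTwoElements 𝔄 →
    let open ContinuousMonoidHomomorphism
        ⟨1⟩ = 𝔅 ExistentiallyInterpretableIn 𝔄
        ⟨2⟩ = ∃ λ (f : ContinuousMonoidHomomorphism 𝔄 𝔅) → CoveredByFinitelyManyOrbits (image f U)
        ⟨3⟩ = ∃ λ (f : ContinuousMonoidHomomorphism 𝔄 𝔅) → CoveredByFinitelyManyOrbits (image f (Aut 𝔄))
    in (⟨1⟩ ⇔ ⟨2⟩) × (⟨2⟩ ⇔ ⟨3⟩)
theorem7 em 𝔄 𝔅 categorical (x , y , x≢y) =
  mk⇔ (3⇒2 ∘ 1⇒3) 2⇒1 , mk⇔ (λ p → 1⇒3 (2⇒1 p)) 3⇒2
  where
  open ContinuousMonoidHomomorphism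

  orbits = ℵ₀-categorical⇒finiteOrbits em 𝔄 categorical

  1⇒3 : 𝔅 ExistentiallyInterpretableIn 𝔄 →
        ∃ λ (f : ContinuousMonoidHomomorphism 𝔄 𝔅) → CoveredByFinitelyManyOrbits (image f (Aut 𝔄))
  1⇒3 (I , existential) = continuousHomomorphism , finitelyManyOrbits orbits
    where open FromInterpretation em 𝔄 𝔅 I existential

  3⇒2 : (∃ λ (f : ContinuousMonoidHomomorphism 𝔄 𝔅) → CoveredByFinitelyManyOrbits (image f (Aut 𝔄))) →
        ∃ λ (f : ContinuousMonoidHomomorphism 𝔄 𝔅) → CoveredByFinitelyManyOrbits (image f U)
  3⇒2 (f , bs , covers) = f , bs , λ b →
    Any.map (λ (g , (σ , _ , eq) , orbit) → g , (σ , _ , eq) , orbit) (covers b)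

  2⇒1 : (∃ λ (f : ContinuousMonoidHomomorphism 𝔄 𝔅) → CoveredByFinitelyManyOrbits (image f U)) →
        𝔅 ExistentiallyInterpretableIn 𝔄
  2⇒1 (f , bs , covers) =
    let (e , e-surjective) = ℵ₀-categorical⇒enumerable em 𝔄 categorical x in
    FromHomomorphism.interpretable em 𝔄 𝔅 f orbits e e-surjective x y x≢y bs covers
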